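{- Let $p$ be a prime number, let $k\ge 2$ be an integer, let $n>m\ge 1$ be integers, and let $\epsilon_1,\epsilon_2\in\{ -1,+1\}$. Then $f(x)=x^n+\epsilon_1x^m+\epsilon_2 p^k$ is a product of at most $k$ pairwise distinct non-reciprocal irreducible polynomials over $\mathbb{Q}$.
   Context: A polynomial $g(x)$ of degree $s$ with $g(0)\neq 0$ is called reciprocal if $x^s g(1/x)=\pm g(x)$, and non-reciprocal otherwise. -}

module Defs where

open import Data.Nat as ℕ using (ℕ; zero; suc; _≤_; _<_; _∸_)
open import Data.Integer as ℤ using (ℤ)
open import Data.Rational as ℚ using (ℚ; 0ℚ; 1ℚ)
open import Data.List using (List; []; _∷_; replicate; _++_; take; reverse; foldr; length)
open import Data.List.Relation.Unary.All using (All)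
open import Data.List.Relation.Unary.AllPairs using (AllPairs)
open import Data.Product using (Σ; ∃; _×_; _,_)
open import Data.Sum using (_⊎_)
open import Relation.Binary.PropositionalEquality using (_≡_; _≢_)
open import Relation.Nullary using (¬_)

-- Polynomials over ℚ as coefficient lists, lowest degree first
-- (trailing zeros allowed; equality is coefficientwise).
Poly : Set
Poly = List ℚ

coeff : Poly → ℕ → ℚ
coeff []      _       = 0ℚ
coeff (a ∷ _) zero    = a
coeff (_ ∷ p) (suc i) = coeff p i

_≈ₚ_ : Poly → Poly → Set
p ≈ₚ q = ∀ i → coeff p i ≡ coeff q i

infix 4 _≈ₚ_

_+ₚ_ : Poly → Poly → Poly
[]      +ₚ q       = q
(a ∷ p) +ₚ []      = a ∷ p
(a ∷ p) +ₚ (b ∷ q) = (a ℚ.+ b) ∷ (p +ₚ q)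

scale : ℚ → Poly → Poly
scale c []      = []
scale c (a ∷ p) = (c ℚ.* a) ∷ scale c p

negₚ : Poly → Poly
negₚ = scale (ℚ.- 1ℚ)

_*ₚ_ : Poly → Poly → Poly
[]      *ₚ q = []
(a ∷ p) *ₚ q = scale a q +ₚ (0ℚ ∷ (p *ₚ q))

oneₚ : Poly
oneₚ = 1ℚ ∷ []

prodₚ : List Poly → Poly
prodₚ = foldr _*ₚ_ oneₚ

monomial : ℕ → ℚ → Poly
monomial i c = replicate i 0ℚ ++ (c ∷ [])

HasDegree : Poly → ℕ → Set
HasDegree g d = coeff g d ≢ 0ℚ × (∀ i → d < i → coeff g i ≡ 0ℚ)

IsUnit : Poly → Set
IsUnit g = Σ ℚ λ c → c ≢ 0ℚ × g ≈ₚ (c ∷ [])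

IsZero : Poly → Set
IsZero g = g ≈ₚ []

Irreducible : Poly → Set
Irreducible g = ¬ IsZero g × ¬ IsUnit g
  × (∀ a b → g ≈ₚ (a *ₚ b) → IsUnit a ⊎ IsUnit b)

Associated : Poly → Poly → Set
Associated g h = Σ ℚ λ c → c ≢ 0ℚ × g ≈ₚ scale c h

-- x^s g(1/x) for g of degree s: reverse the first s+1 coefficients
reciprocalPoly : Poly → ℕ → Poly
reciprocalPoly g s = reverse (take (suc s) g)

Reciprocal : Poly → Set
Reciprocal g = Σ ℕ λ s → HasDegree g s × coeff g 0 ≢ 0ℚ
  × (reciprocalPoly g s ≈ₚ g ⊎ reciprocalPoly g s ≈ₚ negₚ g)

NonReciprocal : Poly → Set
NonReciprocal g = coeff g 0 ≢ 0ℚ × ¬ Reciprocal g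

ℕ→ℚ : ℕ → ℚ
ℕ→ℚ n = ℤ.+ n ℚ./ 1

trinomial : ℕ → ℕ → ℚ → ℚ → ℕ → ℕ → Poly
trinomial n m ε₁ ε₂ p k =
  monomial n 1ℚ +ₚ (monomial m ε₁ +ₚ (ε₂ ℚ.* ℕ→ℚ (p ℕ.^ k) ∷ []))

IsSign : ℚ → Set
IsSign ε = ε ≡ 1ℚ ⊎ ε ≡ ℚ.- 1ℚ

{-# OPTIONS --safe #-}
module Submission where

-- The monic integer factors of f are found by Kronecker's method, and Gauss's lemma makes them irreducible
-- over ℚ. No nonconstant factor g ∈ ℤ[x] has g(0) = ±1: the constant term of f exceeds the sum of the other
-- coefficients, so the integer power series 1/g = h/f has coefficients tending to 0 and is a polynomial.
-- Hence p ∣ g(0) for every factor, which allows at most k of them, and none is reciprocal, since a monic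
-- reciprocal g has g(0) = ±1. A repeated monic factor would divide n x^(n−m) + ε₁ m and force n ∣ m.

open import Defs
open import Data.Nat using (ℕ; zero; suc; _≤_; _<_; z≤n; s≤s)
open import Data.Nat.Primality using (Prime; euclidsLemma; prime⇒nonZero; prime⇒nonTrivial)
open import Data.Rational using (ℚ)
open import Data.List using (List; []; _∷_; _++_; length; map)
open import Data.List.Relation.Unary.All as All using (All; []; _∷_)
open import Data.List.Relation.Unary.AllPairs using (AllPairs; []; _∷_)
open import Data.Product using (Σ; ∃; ∃₂; _×_; _,_; proj₁; proj₂)
open import Data.Sum using (_⊎_; inj₁; inj₂)
open import Data.Empty using (⊥-elim)
open import Data.Integer using (ℤ; +_; -[1+_]; ∣_∣; _+_; _*_; _-_; -_)
open import Data.Integer.Divisibility.Signed using (_∣_; quotient; _∣?_; ∣m+n∣m⇒∣n; divides; ∣ᵤ⇒∣; ∣⇒∣ᵤ; ∣m∣n⇒∣m+n; ∣m+n∣n⇒∣m; ∣m⇒∣m*n; ∣n⇒∣m*n)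
open import Data.Integer.Tactic.RingSolver using (solve-∀)
open import Function using (_∘_)
open import Relation.Nullary using (¬_; Dec; yes; no)
open import Relation.Binary.PropositionalEquality using (_≡_; _≢_; _≗_; refl; sym; trans; cong; cong₂; subst; module ≡-Reasoning)
import Data.Rational as ℚ
import Data.Rational.Properties as ℚ
import Data.Rational.Unnormalised as ℚᵘ
import Data.Rational.Unnormalised.Properties as ℚᵘ
import Data.Nat as ℕ
import Data.Nat.Properties as ℕ
import Data.Nat.Divisibility as ℕ
import Data.Integer.Properties as ℤ
open import Data.Nat.Induction using (<-rec)
open import Data.List using (upTo; cartesianProductWith; reverse; take)
open import Data.List.Membership.Propositional using (_∈_)
open import Data.List.Membership.Propositional.Properties using (∈-++⁺ˡ; ∈-++⁺ʳ; ∈-map⁺; ∈-upTo⁺)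
open import Data.List.Relation.Unary.Any as Any using (Any; here; any?)
open import Data.List.Relation.Unary.Any.Properties using (cartesianProductWith⁺)
open import Relation.Nullary.Decidable using (¬?; _×-dec_)
import Data.List.Relation.Unary.All.Properties as All
import Data.List.Relation.Unary.AllPairs.Properties as AllPairs
open import Algebra.Bundles using (CommutativeMonoid)
open import Algebra.Properties.CommutativeSemigroup (CommutativeMonoid.commutativeSemigroup ℚ.*-1-commutativeMonoid) using (interchange; xy∙z≈xz∙y; x∙yz≈xz∙y)
open import Data.List.Properties using (reverse-++; length-map)
open import Data.Nat.ListAction using (product)
open import Data.Nat.Primality.Factorisation using (PrimeFactorisation; factorise)
open import Data.Rational.Literals renaming (fromℤ to ι)

-- `Irreducible` asks for a decided alternative `IsUnit a ⊎ IsUnit b`, and the list of factors has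
-- to be produced, so for every monic factor it must be decided whether it splits further; a finite
-- search does this where an appeal to a factor of least degree would not. The power series 1/g has
-- to be multiplied with polynomials, so both live in `ℕ → ℤ` under one convolution, and being a
-- polynomial is a separate property, `Bounded`. The coefficients of q = 1/g tend to 0 for the
-- following reason. Far out they satisfy c q(n+N) = -(ε₁ q(n-m+N) + q(N)) with c = ε₂ p^k, so a
-- bound M + 1 improves to 2(M + 1)/|c|. This is less than M + 1 because k ≥ 2 gives |c| ≥ 4, and
-- among integers every improvement is at least 1. The count of factors compares constant terms:
-- their product is ± p^k and each has absolute value at least p.

-- Integer sequences under convolution

Seq : Set
Seq = ℕ → ℤ

tail : Seq → Seq
tail f i = f (suc i)

infixl 7 _⊛_ _·_

-- Splitting off the constant term of the left factor, as _*ₚ_ does on lists.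
_⊛_ : Seq → Seq → Seq
(f ⊛ g) zero    = f 0 * g 0
(f ⊛ g) (suc n) = f 0 * g (suc n) + (tail f ⊛ g) n

_·_ : ℤ → Seq → Seq
(c · f) i = c * f i

_⊕_ : Seq → Seq → Seq
(f ⊕ g) i = f i + g i

𝟘 : Seq
𝟘 _ = + 0

mono : ℕ → ℤ → Seq
mono zero    c zero    = c
mono zero    c (suc _) = + 0
mono (suc i) c zero    = + 0
mono (suc i) c (suc j) = mono i c j

𝟙 : Seq
𝟙 = mono 0 (+ 1)

⊛-cong : ∀ {f f′ g g′} → f ≗ f′ → g ≗ g′ → f ⊛ g ≗ f′ ⊛ g′
⊛-cong p q zero    = cong₂ _*_ (p 0) (q 0)
⊛-cong p q (suc n) = cong₂ _+_ (cong₂ _*_ (p 0) (q (suc n))) (⊛-cong (p ∘ suc) q n)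

⊛-congˡ : ∀ f {g g′} → g ≗ g′ → f ⊛ g ≗ f ⊛ g′
⊛-congˡ f = ⊛-cong {f} (λ _ → refl)

⊛-congʳ : ∀ g {f f′} → f ≗ f′ → f ⊛ g ≗ f′ ⊛ g
⊛-congʳ g p = ⊛-cong {g = g} p (λ _ → refl)

⊛-zeroˡ : ∀ {f} → f ≗ 𝟘 → ∀ g → f ⊛ g ≗ 𝟘
⊛-zeroˡ z g zero    rewrite z 0 = refl
⊛-zeroˡ z g (suc n) rewrite z 0 = trans (ℤ.+-identityˡ _) (⊛-zeroˡ (z ∘ suc) g n)

⊛-distribʳ : ∀ h f g → (f ⊕ g) ⊛ h ≗ (f ⊛ h) ⊕ (g ⊛ h)
⊛-distribʳ h f g zero    = ℤ.*-distribʳ-+ (h 0) (f 0) (g 0)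
⊛-distribʳ h f g (suc n) =
  trans (cong (_+_ ((f 0 + g 0) * h (suc n))) (⊛-distribʳ h (tail f) (tail g) n))
        (aux (f 0) (g 0) (h (suc n)) ((tail f ⊛ h) n) ((tail g ⊛ h) n))
  where
  aux : ∀ a b c x y → (a + b) * c + (x + y) ≡ (a * c + x) + (b * c + y)
  aux = solve-∀

·-⊛ : ∀ c f g → (c · f) ⊛ g ≗ c · (f ⊛ g)
·-⊛ c f g zero    = ℤ.*-assoc c (f 0) (g 0)
·-⊛ c f g (suc n) =
  trans (cong (_+_ (c * f 0 * g (suc n))) (·-⊛ c (tail f) g n)) (aux c (f 0) (g (suc n)) ((tail f ⊛ g) n))
  where
  aux : ∀ c a b x → c * a * b + c * x ≡ c * (a * b + x)
  aux = solve-∀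

-- Mirror image of the recursion that defines `_⊛_`; comparing the two gives commutativity, and
-- Gauss's lemma uses it to recurse on the right factor.
⊛-sucʳ : ∀ f g n → (f ⊛ g) (suc n) ≡ f (suc n) * g 0 + (f ⊛ tail g) n
⊛-sucʳ f g zero    = ℤ.+-comm (f 0 * g 1) (f 1 * g 0)
⊛-sucʳ f g (suc n) =
  trans (cong (_+_ (f 0 * g (suc (suc n)))) (⊛-sucʳ (tail f) g n)) (aux (f 0 * g (suc (suc n))) (f (suc (suc n)) * g 0) ((tail f ⊛ tail g) n))
  where
  aux : ∀ a b c → a + (b + c) ≡ b + (a + c)
  aux = solve-∀

⊛-comm : ∀ f g → f ⊛ g ≗ g ⊛ f
⊛-comm f g zero    = ℤ.*-comm (f 0) (g 0)
⊛-comm f g (suc n) =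
  trans (cong₂ _+_ (ℤ.*-comm (f 0) (g (suc n))) (⊛-comm (tail f) g n)) (sym (⊛-sucʳ g f n))

⊛-assoc : ∀ f g h → (f ⊛ g) ⊛ h ≗ f ⊛ (g ⊛ h)
⊛-assoc f g h zero    = ℤ.*-assoc (f 0) (g 0) (h 0)
⊛-assoc f g h (suc n) = begin
  f 0 * g 0 * h (suc n) + (((f 0 · tail g) ⊕ (tail f ⊛ g)) ⊛ h) n
    ≡⟨ cong (_+_ (f 0 * g 0 * h (suc n))) (⊛-distribʳ h (f 0 · tail g) (tail f ⊛ g) n) ⟩
  f 0 * g 0 * h (suc n) + (((f 0 · tail g) ⊛ h) n + ((tail f ⊛ g) ⊛ h) n)
    ≡⟨ cong (_+_ (f 0 * g 0 * h (suc n))) (cong₂ _+_ (·-⊛ (f 0) (tail g) h n) (⊛-assoc (tail f) g h n)) ⟩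
  f 0 * g 0 * h (suc n) + (f 0 * (tail g ⊛ h) n + (tail f ⊛ (g ⊛ h)) n)
    ≡⟨ aux (f 0) (g 0) (h (suc n)) ((tail g ⊛ h) n) ((tail f ⊛ (g ⊛ h)) n) ⟩
  f 0 * (g 0 * h (suc n) + (tail g ⊛ h) n) + (tail f ⊛ (g ⊛ h)) n ∎
  where
  open ≡-Reasoning
  aux : ∀ a b c x y → a * b * c + (a * x + y) ≡ a * (b * c + x) + y
  aux = solve-∀

⊛-· : ∀ c f g → f ⊛ (c · g) ≗ c · (f ⊛ g)
⊛-· c f g n =
  trans (⊛-comm f (c · g) n) (trans (·-⊛ c g f n) (cong (c *_) (⊛-comm g f n)))

⊛-const : ∀ f g → tail f ≗ 𝟘 → f ⊛ g ≗ f 0 · g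
⊛-const f g z zero    = refl
⊛-const f g z (suc n) = trans (cong (_+_ (f 0 * g (suc n))) (⊛-zeroˡ z g n)) (ℤ.+-identityʳ _)

⊛-identityˡ : ∀ f → 𝟙 ⊛ f ≗ f
⊛-identityˡ f n = trans (⊛-const 𝟙 f (λ _ → refl) n) (ℤ.*-identityˡ (f n))

⊛-identityʳ : ∀ f → f ⊛ 𝟙 ≗ f
⊛-identityʳ f n = trans (⊛-comm f 𝟙 n) (⊛-identityˡ f n)

mono-⊛ : ∀ i c f N → (mono i c ⊛ f) (i ℕ.+ N) ≡ c * f N
mono-⊛ zero    c f N = ⊛-const (mono 0 c) f (λ _ → refl) N
mono-⊛ (suc i) c f N = trans (ℤ.+-identityˡ _) (mono-⊛ i c f N)

mono-at : ∀ i c → mono i c i ≡ c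
mono-at zero    c = refl
mono-at (suc i) c = mono-at i c

mono-off : ∀ i c j → i ≢ j → mono i c j ≡ + 0
mono-off zero    c zero    i≢j = ⊥-elim (i≢j refl)
mono-off zero    c (suc j) i≢j = refl
mono-off (suc i) c zero    i≢j = refl
mono-off (suc i) c (suc j) i≢j = mono-off i c j (i≢j ∘ cong suc)

-- Polynomials as eventually vanishing sequences: degree and leading coefficient

-- Degree strictly less than `d`, so that `Below 0` is the zero polynomial and `Below 1` a constant,
-- with no convention for the degree of 0.
Below : ℕ → Seq → Set
Below d f = ∀ i → d ≤ i → f i ≡ + 0

Bounded : Seq → Set
Bounded f = ∃ λ d → Below d f

Below-weaken : ∀ {d e f} → d ≤ e → Below d f → Below e f
Below-weaken d≤e b i e≤i = b i (ℕ.≤-trans d≤e e≤i)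

Below-resp : ∀ {d f g} → f ≗ g → Below d f → Below d g
Below-resp f≗g b i d≤i = trans (sym (f≗g i)) (b i d≤i)

Below-tail : ∀ {d f} → Below (suc d) f → Below d (tail f)
Below-tail b i d≤i = b (suc i) (s≤s d≤i)

Below-0 : ∀ {f} → Below 0 f → f ≗ 𝟘
Below-0 b i = b i z≤n

⊛-below : ∀ d {f e g} → Below (suc d) f → Below e g → Below (d ℕ.+ e) (f ⊛ g)
⊛-below zero {f} {e} {g} bf bg i e≤i = begin
  (f ⊛ g) i ≡⟨ ⊛-const f g (λ j → bf (suc j) (s≤s z≤n)) i ⟩
  f 0 * g i ≡⟨ cong (f 0 *_) (bg i e≤i) ⟩
  f 0 * + 0 ≡⟨ ℤ.*-zeroʳ (f 0) ⟩
  + 0       ∎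
  where open ≡-Reasoning
⊛-below (suc d) {f} {e} {g} bf bg (suc i) (s≤s le) = begin
  f 0 * g (suc i) + (tail f ⊛ g) i
    ≡⟨ cong₂ (λ x y → f 0 * x + y)
         (bg (suc i) (ℕ.≤-trans (ℕ.m≤n+m e d) (ℕ.m≤n⇒m≤1+n le)))
         (⊛-below d (Below-tail bf) bg i le) ⟩
  f 0 * + 0 + + 0 ≡⟨ cong (_+ + 0) (ℤ.*-zeroʳ (f 0)) ⟩
  + 0 ∎
  where open ≡-Reasoning

⊛-top : ∀ d {f e g} → Below (suc d) f → Below (suc e) g → (f ⊛ g) (d ℕ.+ e) ≡ f d * g e
⊛-top zero {f} {e} {g} bf bg = ⊛-const f g (λ j → bf (suc j) (s≤s z≤n)) e
⊛-top (suc d) {f} {e} {g} bf bg = begin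
  f 0 * g (suc (d ℕ.+ e)) + (tail f ⊛ g) (d ℕ.+ e)
    ≡⟨ cong₂ (λ x y → f 0 * x + y)
         (bg (suc (d ℕ.+ e)) (s≤s (ℕ.m≤n+m e d)))
         (⊛-top d (Below-tail bf) bg) ⟩
  f 0 * + 0 + f (suc d) * g e ≡⟨ cong (_+ f (suc d) * g e) (ℤ.*-zeroʳ (f 0)) ⟩
  + 0 + f (suc d) * g e       ≡⟨ ℤ.+-identityˡ _ ⟩
  f (suc d) * g e             ∎
  where open ≡-Reasoning

Bounded-⊛ : ∀ {f g} → Bounded f → Bounded g → Bounded (f ⊛ g)
Bounded-⊛ (d , bf) (e , bg) = d ℕ.+ e , ⊛-below d (Below-weaken (ℕ.n≤1+n d) bf) bg

HasDeg : ℕ → Seq → Set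
HasDeg d f = f d ≢ + 0 × Below (suc d) f

Monic : ℕ → Seq → Set
Monic d f = f d ≡ + 1 × Below (suc d) f

degree : ∀ N {f} → Below N f → f ≗ 𝟘 ⊎ ∃ λ d → HasDeg d f
degree zero    b = inj₁ (Below-0 b)
degree (suc N) {f} b with f N ℤ.≟ + 0
... | no fN≢0 = inj₂ (N , fN≢0 , b)
... | yes fN≡0 = degree N λ i N≤i → case i N≤i
  where
  case : ∀ i → N ≤ i → f i ≡ + 0
  case i N≤i with ℕ.m≤n⇒m<n∨m≡n N≤i
  ... | inj₁ N<i  = b i N<i
  ... | inj₂ refl = fN≡0

HasDeg-unique : ∀ {d e f} → HasDeg d f → HasDeg e f → d ≡ e
HasDeg-unique (d≢ , bd) (e≢ , be) =
  ℕ.≤-antisym (ℕ.≮⇒≥ λ e<d → d≢ (be _ e<d)) (ℕ.≮⇒≥ λ d<e → e≢ (bd _ d<e))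

Monic⇒HasDeg : ∀ {d f} → Monic d f → HasDeg d f
Monic⇒HasDeg (t , b) = (λ z → case (trans (sym t) z)) , b
  where
  case : ¬ (+ 1 ≡ + 0)
  case ()

*-≢0 : ∀ {i j} → i ≢ + 0 → j ≢ + 0 → i * j ≢ + 0
*-≢0 {i} i≢0 j≢0 eq with ℤ.i*j≡0⇒i≡0∨j≡0 i eq
... | inj₁ i≡0 = i≢0 i≡0
... | inj₂ j≡0 = j≢0 j≡0

HasDeg-⊛ : ∀ {d e f g} → HasDeg d f → HasDeg e g → HasDeg (d ℕ.+ e) (f ⊛ g)
HasDeg-⊛ {d} {e} {f} {g} (d≢ , bf) (e≢ , bg) =
  (λ z → *-≢0 d≢ e≢ (trans (sym (⊛-top d bf bg)) z)) ,
  subst (λ k → Below k (f ⊛ g)) (ℕ.+-suc d e) (⊛-below d bf bg)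

abs≡1 : ∀ i → ∣ i ∣ ≡ 1 → i ≡ + 1 ⊎ i ≡ - + 1
abs≡1 (+ _)    refl = inj₁ refl
abs≡1 -[1+ _ ] refl = inj₂ refl

unit-product : ∀ i j → i * j ≡ + 1 → i ≡ j × i * i ≡ + 1
unit-product i j eq with trans (sym (ℤ.abs-* i j)) (cong ∣_∣ eq)
... | ab≡1 with abs≡1 i (ℕ.m*n≡1⇒m≡1 ∣ i ∣ ∣ j ∣ ab≡1) | abs≡1 j (ℕ.m*n≡1⇒n≡1 ∣ i ∣ ∣ j ∣ ab≡1)
... | inj₁ refl | inj₁ refl = refl , refl
... | inj₂ refl | inj₂ refl = refl , refl
... | inj₁ refl | inj₂ refl with () ← eq
... | inj₂ refl | inj₁ refl with () ← eq

-- The leading coefficients of the factors are both 1 or both −1.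
monic-factors : ∀ {n G A B} → Monic n G → Bounded A → Bounded B → G ≗ A ⊛ B →
  ∃ λ d → ∃ λ e → ∃ λ s → d ℕ.+ e ≡ n × s * s ≡ + 1 ×
    Monic d (s · A) × Monic e (s · B) × G ≗ (s · A) ⊛ (s · B)
monic-factors {n} {G} {A} {B} mG (N , bA) (M , bB) eq with degree N bA | degree M bB
... | inj₁ A≗0 | _ = ⊥-elim (proj₁ (Monic⇒HasDeg mG) (trans (eq n) (⊛-zeroˡ A≗0 B n)))
... | inj₂ _ | inj₁ B≗0 =
  ⊥-elim (proj₁ (Monic⇒HasDeg mG) (trans (eq n) (trans (⊛-comm A B n) (⊛-zeroˡ B≗0 A n))))
... | inj₂ (d , hA) | inj₂ (e , hB) =
  d , e , A d , d+e≡n , ss≡1 , (ss≡1 , scaled hA) , (trans (cong (_* B e) Ad≡Be) (trans (cong₂ _*_ (sym Ad≡Be) (sym Ad≡Be)) ss≡1) , scaled hB) , split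
  where
  d+e≡n : d ℕ.+ e ≡ n
  d+e≡n = HasDeg-unique (HasDeg-⊛ hA hB)
    ((λ z → proj₁ (Monic⇒HasDeg mG) (trans (eq n) z)) , Below-resp eq (proj₂ mG))
  unit : A d ≡ B e × A d * A d ≡ + 1
  unit = unit-product (A d) (B e)
    (trans (sym (⊛-top d (proj₂ hA) (proj₂ hB)))
           (trans (sym (eq _)) (trans (cong G d+e≡n) (proj₁ mG))))
  Ad≡Be = proj₁ unit
  ss≡1 = proj₂ unit
  scaled : ∀ {k f} → HasDeg k f → Below (suc k) (A d · f)
  scaled (_ , b) i k<i = trans (cong (A d *_) (b i k<i)) (ℤ.*-zeroʳ (A d))
  split : G ≗ (A d · A) ⊛ (A d · B)
  split i = begin
    G i                           ≡⟨ eq i ⟩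
    (A ⊛ B) i                     ≡⟨ ℤ.*-identityˡ _ ⟨
    + 1 * (A ⊛ B) i               ≡⟨ cong (_* (A ⊛ B) i) ss≡1 ⟨
    A d * A d * (A ⊛ B) i         ≡⟨ ℤ.*-assoc (A d) (A d) _ ⟩
    A d * (A d * (A ⊛ B) i)       ≡⟨ cong (A d *_) (⊛-· (A d) A B i) ⟨
    A d * (A ⊛ (A d · B)) i       ≡⟨ ·-⊛ (A d) A (A d · B) i ⟨
    ((A d · A) ⊛ (A d · B)) i     ∎
    where open ≡-Reasoning

-- Divisors with unit constant term

-- A coefficient of a product sees only a finite part of `g`, so a recursively computed inverse may
-- be replaced by any approximation that is correct so far.
⊛-cong-≤ : ∀ f {g g′} n → (∀ i → i ≤ n → g i ≡ g′ i) → (f ⊛ g) n ≡ (f ⊛ g′) n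
⊛-cong-≤ f zero    p = cong (f 0 *_) (p 0 z≤n)
⊛-cong-≤ f (suc n) p =
  cong₂ (λ x y → f 0 * x + y) (p (suc n) ℕ.≤-refl)
        (⊛-cong-≤ (tail f) n λ i i≤n → p i (ℕ.m≤n⇒m≤1+n i≤n))

-- The constant term is its own inverse, so g q = 1 can be solved coefficient by coefficient without
-- division.
module PowerSeriesInverse (g : Seq) (unit : g 0 * g 0 ≡ + 1) where

  -- Coefficient n + 1 of the inverse needs all earlier ones, which is not structural in n;
  -- recursion on the fuel `k` is. Entry n is correct once k > n, so the default 0 never reaches
  -- `inverse`.
  approx : ℕ → Seq
  approx zero    _       = + 0
  approx (suc k) zero    = g 0
  approx (suc k) (suc n) = - (g 0 * (tail g ⊛ approx k) n)

  inverse : Seq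
  inverse n = approx (suc n) n

  approx-stable : ∀ k l n → n < k → n < l → approx k n ≡ approx l n
  approx-stable (suc k) (suc l) zero    _         _         = refl
  approx-stable (suc k) (suc l) (suc n) (s≤s n<k) (s≤s n<l) =
    cong (λ x → - (g 0 * x)) (⊛-cong-≤ (tail g) n λ i i≤n →
      approx-stable k l i (ℕ.≤-<-trans i≤n n<k) (ℕ.≤-<-trans i≤n n<l))

  ⊛-inverse : g ⊛ inverse ≗ 𝟙
  ⊛-inverse zero    = unit
  ⊛-inverse (suc n) = begin
    g 0 * - (g 0 * (tail g ⊛ approx (suc n)) n) + (tail g ⊛ inverse) n
      ≡⟨ cong (λ x → g 0 * - (g 0 * x) + (tail g ⊛ inverse) n)
           (⊛-cong-≤ (tail g) n λ i i≤n → approx-stable (suc n) (suc i) i (s≤s i≤n) ℕ.≤-refl) ⟩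
    g 0 * - (g 0 * (tail g ⊛ inverse) n) + (tail g ⊛ inverse) n
      ≡⟨ aux (g 0) ((tail g ⊛ inverse) n) ⟩
    (+ 1 - g 0 * g 0) * (tail g ⊛ inverse) n
      ≡⟨ cong (λ u → (+ 1 - u) * (tail g ⊛ inverse) n) unit ⟩
    + 0 ∎
    where
    open ≡-Reasoning
    aux : ∀ a x → a * - (a * x) + x ≡ (+ 1 - a * a) * x
    aux = solve-∀

bound-initial : ∀ (q : Seq) K → ∃ λ M → ∀ i → i < K → ∣ q i ∣ ≤ M
bound-initial q zero    = 0 , λ _ ()
bound-initial q (suc K) with bound-initial q K
... | M , bM = M ℕ.+ ∣ q K ∣ , bound
  where
  bound : ∀ i → i < suc K → ∣ q i ∣ ≤ M ℕ.+ ∣ q K ∣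
  bound i (s≤s i≤K) with ℕ.m≤n⇒m<n∨m≡n i≤K
  ... | inj₁ i<K  = ℕ.≤-trans (bM i i<K) (ℕ.m≤m+n M _)
  ... | inj₂ refl = ℕ.m≤n+m _ M

module Contraction (q : Seq) (P n j e : ℕ) (3≤P : 3 ≤ P) (j<n : j < n)
  (recurrence : ∀ N → e ≤ N → P ℕ.* ∣ q (n ℕ.+ N) ∣ ≤ ∣ q (j ℕ.+ N) ∣ ℕ.+ ∣ q N ∣) where

  -- Were the value at n + N at least M + 1, the left side of the recurrence would be at least 3(M +
  -- 1), but its right side is at most 2(M + 1).
  shrink : ∀ M N → e ≤ N → ∣ q (j ℕ.+ N) ∣ ≤ suc M → ∣ q N ∣ ≤ suc M → ∣ q (n ℕ.+ N) ∣ ≤ M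
  shrink M N e≤N bj b0 = ℕ.≮⇒≥ λ M<x → ℕ.<-irrefl refl (begin-strict
    suc M ℕ.+ suc M               <⟨ ℕ.m<n+m (suc M ℕ.+ suc M) {suc M} (s≤s z≤n) ⟩
    suc M ℕ.+ (suc M ℕ.+ suc M)   ≡⟨ cong (λ x → suc M ℕ.+ (suc M ℕ.+ x)) (ℕ.+-identityʳ (suc M)) ⟨
    3 ℕ.* suc M                   ≤⟨ ℕ.*-mono-≤ 3≤P M<x ⟩
    P ℕ.* ∣ q (n ℕ.+ N) ∣         ≤⟨ recurrence N e≤N ⟩
    ∣ q (j ℕ.+ N) ∣ ℕ.+ ∣ q N ∣   ≤⟨ ℕ.+-mono-≤ bj b0 ⟩
    suc M ℕ.+ suc M               ∎)
    where open ℕ.≤-Reasoning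

  bounded : ∃ λ M → ∀ i → ∣ q i ∣ ≤ M
  bounded with bound-initial q (n ℕ.+ e)
  -- `shrink` works with bounds of the form `suc M`, so the bound on the initial values is raised by
  -- one.
  ... | M , bM = suc M , <-rec (λ i → ∣ q i ∣ ≤ suc M) step
    where
    step : ∀ i → (∀ {l} → l < i → ∣ q l ∣ ≤ suc M) → ∣ q i ∣ ≤ suc M
    step i rec with i ℕ.<? n ℕ.+ e
    ... | yes i<n+e = ℕ.m≤n⇒m≤1+n (bM i i<n+e)
    ... | no i≮n+e with ℕ.m≤n⇒∃[o]m+o≡n (ℕ.≮⇒≥ i≮n+e)
    ... | o , refl rewrite ℕ.+-assoc n e o =
      ℕ.m≤n⇒m≤1+n (shrink M (e ℕ.+ o) (ℕ.m≤m+n e o)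
        (rec (ℕ.+-monoˡ-< (e ℕ.+ o) j<n))
        (rec (ℕ.m<n+m (e ℕ.+ o) (ℕ.≤-<-trans z≤n j<n))))

  -- Beyond `n + E` every index is n + N with N ≥ E, so one use of `shrink` lowers the bound there
  -- by one; when it reaches 0 the sequence has ended.
  descent : ∀ M E → e ≤ E → (∀ i → E ≤ i → ∣ q i ∣ ≤ M) → Bounded q
  descent zero    E e≤E bM = E , λ i E≤i → ℤ.∣i∣≡0⇒i≡0 (ℕ.n≤0⇒n≡0 (bM i E≤i))
  descent (suc M) E e≤E bM = descent M (n ℕ.+ E) (ℕ.≤-trans e≤E (ℕ.m≤n+m E n)) smaller
    where
    smaller : ∀ i → n ℕ.+ E ≤ i → ∣ q i ∣ ≤ M
    smaller i le with ℕ.m≤n⇒∃[o]m+o≡n le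
    ... | o , refl rewrite ℕ.+-assoc n E o =
      shrink M (E ℕ.+ o) (ℕ.≤-trans e≤E (ℕ.m≤m+n E o))
        (bM _ (ℕ.≤-trans (ℕ.m≤m+n E o) (ℕ.m≤n+m (E ℕ.+ o) j))) (bM _ (ℕ.m≤m+n E o))

  eventually-zero : Bounded q
  eventually-zero with bounded
  ... | M , bM = descent M e ℕ.≤-refl (λ i _ → bM i)

Tri : ℕ → ℕ → ℤ → ℤ → Seq
Tri n m s c = mono n (+ 1) ⊕ (mono m s ⊕ mono 0 c)

-- With n written as m + j, the difference n - m is `j` and no truncated subtraction occurs; at
-- indices from n on, all three shifts are in range.
Tri-⊛ : ∀ m j s c q N →
  (Tri (m ℕ.+ j) m s c ⊛ q) (m ℕ.+ j ℕ.+ N) ≡ q N + (s * q (j ℕ.+ N) + c * q (m ℕ.+ j ℕ.+ N))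
Tri-⊛ m j s c q N = begin
  (Tri n m s c ⊛ q) (n ℕ.+ N)
    ≡⟨ ⊛-distribʳ q (mono n (+ 1)) (mono m s ⊕ mono 0 c) (n ℕ.+ N) ⟩
  (mono n (+ 1) ⊛ q) (n ℕ.+ N) + ((mono m s ⊕ mono 0 c) ⊛ q) (n ℕ.+ N)
    ≡⟨ cong₂ _+_ (trans (mono-⊛ n (+ 1) q N) (ℤ.*-identityˡ (q N)))
                 (⊛-distribʳ q (mono m s) (mono 0 c) (n ℕ.+ N)) ⟩
  q N + ((mono m s ⊛ q) (n ℕ.+ N) + (mono 0 c ⊛ q) (n ℕ.+ N))
    ≡⟨ cong (_+_ (q N)) (cong₂ _+_
         (trans (cong (mono m s ⊛ q) (ℕ.+-assoc m j N)) (mono-⊛ m s q (j ℕ.+ N)))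
         (mono-⊛ 0 c q (n ℕ.+ N))) ⟩
  q N + (s * q (j ℕ.+ N) + c * q (n ℕ.+ N)) ∎
  where
  open ≡-Reasoning
  n = m ℕ.+ j

HasDeg-𝟙 : HasDeg 0 𝟙
HasDeg-𝟙 = (λ ()) , λ { (suc i) _ → refl }

-- Degrees add, and the product 1 has degree 0.
invertible⇒const : ∀ {f g} → Bounded f → Bounded g → f ⊛ g ≗ 𝟙 → Below 1 f
invertible⇒const {f} {g} (N , bf) (M , bg) eq with degree N bf | degree M bg
... | inj₁ f≗0 | _ with () ← trans (sym (eq 0)) (⊛-zeroˡ f≗0 g 0)
invertible⇒const {f} {g} (N , bf) (M , bg) eq | inj₂ _ | inj₁ g≗0
  with () ← trans (sym (eq 0)) (trans (⊛-comm f g 0) (⊛-zeroˡ g≗0 f 0))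
invertible⇒const {f} {g} (N , bf) (M , bg) eq | inj₂ (d , hf) | inj₂ (e , hg) =
  subst (λ k → Below (suc k) f) (ℕ.m+n≡0⇒m≡0 d d+e≡0) (proj₂ hf)
  where
  h : HasDeg (d ℕ.+ e) 𝟙
  h with HasDeg-⊛ hf hg
  ... | top , b = (λ z → top (trans (eq (d ℕ.+ e)) z)) , Below-resp eq b
  d+e≡0 : d ℕ.+ e ≡ 0
  d+e≡0 = HasDeg-unique h HasDeg-𝟙

-- If g(0) = ±1, then q = 1/g has integer coefficients and f q = h is a polynomial, so q satisfies
-- the recurrence of f from some point on. It makes |q| shrink, so q vanishes eventually.
unit-constant⇒const : ∀ m j s c {g h} → 1 ≤ m → ∣ s ∣ ≡ 1 → 3 ≤ ∣ c ∣ →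
  Bounded g → Bounded h → Tri (m ℕ.+ j) m s c ≗ g ⊛ h → g 0 * g 0 ≡ + 1 → Below 1 g
unit-constant⇒const m j s c {g} {h} 1≤m ∣s∣≡1 3≤∣c∣ bg (e , bh) eq unit =
  invertible⇒const bg (Contraction.eventually-zero q ∣ c ∣ n j e 3≤∣c∣ j<n recurrence) ⊛-inverse
  where
  n = m ℕ.+ j
  open PowerSeriesInverse g unit renaming (inverse to q)
  j<n : j < n
  j<n = ℕ.m<n+m j 1≤m
  Tq≗h : Tri n m s c ⊛ q ≗ h
  Tq≗h i = begin
    (Tri n m s c ⊛ q) i ≡⟨ ⊛-congʳ q eq i ⟩
    ((g ⊛ h) ⊛ q) i     ≡⟨ ⊛-congʳ q (⊛-comm g h) i ⟩
    ((h ⊛ g) ⊛ q) i     ≡⟨ ⊛-assoc h g q i ⟩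
    (h ⊛ (g ⊛ q)) i     ≡⟨ ⊛-congˡ h ⊛-inverse i ⟩
    (h ⊛ 𝟙) i           ≡⟨ ⊛-identityʳ h i ⟩
    h i                 ∎
    where open ≡-Reasoning
  isolate : ∀ a b x → a + (b + x) ≡ + 0 → x ≡ - (b + a)
  isolate a b x z = trans (sym (aux a b x)) (trans (cong (_- (b + a)) z) (ℤ.+-identityˡ (- (b + a))))
    where
    aux : ∀ a b x → a + (b + x) - (b + a) ≡ x
    aux = solve-∀
  -- From `e` on the coefficients of f q = h vanish, which makes the recurrence homogeneous.
  recurrence : ∀ N → e ≤ N → ∣ c ∣ ℕ.* ∣ q (n ℕ.+ N) ∣ ≤ ∣ q (j ℕ.+ N) ∣ ℕ.+ ∣ q N ∣
  recurrence N e≤N = begin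
    ∣ c ∣ ℕ.* ∣ q (n ℕ.+ N) ∣ ≡⟨ ℤ.abs-* c (q (n ℕ.+ N)) ⟨
    ∣ c * q (n ℕ.+ N) ∣       ≡⟨ cong ∣_∣ (isolate (q N) (s * q (j ℕ.+ N)) (c * q (n ℕ.+ N)) vanish) ⟩
    ∣ - (s * q (j ℕ.+ N) + q N) ∣     ≡⟨ ℤ.∣-i∣≡∣i∣ (s * q (j ℕ.+ N) + q N) ⟩
    ∣ s * q (j ℕ.+ N) + q N ∣         ≤⟨ ℤ.∣i+j∣≤∣i∣+∣j∣ (s * q (j ℕ.+ N)) (q N) ⟩
    ∣ s * q (j ℕ.+ N) ∣ ℕ.+ ∣ q N ∣   ≡⟨ cong (ℕ._+ ∣ q N ∣) (ℤ.abs-* s (q (j ℕ.+ N))) ⟩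
    ∣ s ∣ ℕ.* ∣ q (j ℕ.+ N) ∣ ℕ.+ ∣ q N ∣ ≡⟨ cong (λ x → x ℕ.* ∣ q (j ℕ.+ N) ∣ ℕ.+ ∣ q N ∣) ∣s∣≡1 ⟩
    1 ℕ.* ∣ q (j ℕ.+ N) ∣ ℕ.+ ∣ q N ∣ ≡⟨ cong (ℕ._+ ∣ q N ∣) (ℕ.*-identityˡ _) ⟩
    ∣ q (j ℕ.+ N) ∣ ℕ.+ ∣ q N ∣ ∎
    where
    open ℕ.≤-Reasoning
    vanish : q N + (s * q (j ℕ.+ N) + c * q (n ℕ.+ N)) ≡ + 0
    vanish = trans (sym (Tri-⊛ m j s c q N))
                   (trans (Tq≗h (n ℕ.+ N)) (bh _ (ℕ.≤-trans e≤N (ℕ.m≤n+m N n))))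

-- Repeated factors

∣0 : ∀ N → N ∣ + 0
∣0 N = divides (+ 0) refl

∣-⊛ : ∀ {N f} g → (∀ i → N ∣ f i) → ∀ i → N ∣ (f ⊛ g) i
∣-⊛ g p zero    = ∣m⇒∣m*n (g 0) (p 0)
∣-⊛ g p (suc i) = ∣m∣n⇒∣m+n (∣m⇒∣m*n (g (suc i)) (p 0)) (∣-⊛ g (p ∘ suc) i)

-- Modulo N a monic g keeps its degree d, so a nonzero w would give w g a nonzero coefficient at
-- some index ≥ d. The recursion clears the higher coefficients of w first; then index d leaves only
-- w(0) times the leading coefficient 1.
∣-monic-cancel : ∀ {N d g} e {w} → Below e w → Monic d g →
  (∀ i → d ≤ i → N ∣ (w ⊛ g) i) → ∀ i → N ∣ w i
∣-monic-cancel {N} zero bw mg p i = subst (N ∣_) (sym (Below-0 bw i)) (∣0 N)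
∣-monic-cancel {N} {d} {g} (suc e) {w} bw mg p = λ { zero → at-0 d mg p ; (suc i) → at-suc i }
  where
  at-suc : ∀ i → N ∣ w (suc i)
  at-suc = ∣-monic-cancel e (Below-tail bw) mg λ i d≤i →
    subst (N ∣_) (begin
      w 0 * g (suc i) + (tail w ⊛ g) i ≡⟨ cong (λ x → w 0 * x + (tail w ⊛ g) i) (proj₂ mg (suc i) (s≤s d≤i)) ⟩
      w 0 * + 0 + (tail w ⊛ g) i       ≡⟨ cong (_+ (tail w ⊛ g) i) (ℤ.*-zeroʳ (w 0)) ⟩
      + 0 + (tail w ⊛ g) i             ≡⟨ ℤ.+-identityˡ _ ⟩
      (tail w ⊛ g) i                   ∎)
      (p (suc i) (ℕ.m≤n⇒m≤1+n d≤i))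
    where open ≡-Reasoning
  at-0 : ∀ d → Monic d g → (∀ i → d ≤ i → N ∣ (w ⊛ g) i) → N ∣ w 0
  at-0 zero    (g0≡1 , _) p =
    subst (N ∣_) (trans (cong (w 0 *_) g0≡1) (ℤ.*-identityʳ (w 0))) (p 0 z≤n)
  at-0 (suc d) (gd≡1 , _) p =
    subst (N ∣_) (trans (cong (w 0 *_) gd≡1) (ℤ.*-identityʳ (w 0)))
      (∣m+n∣n⇒∣m (p (suc d) ℕ.≤-refl) (∣-⊛ g at-suc d))

-- If x^m divides w g and g(0) ≠ 0, then x^m divides w; one factor x is removed at a time.
strip : ∀ m {f g w} → g 0 ≢ + 0 → Bounded w → (∀ i → i < m → f i ≡ + 0) → f ≗ w ⊛ g →
  ∃ λ w′ → Bounded w′ × (∀ i → f (m ℕ.+ i) ≡ (w′ ⊛ g) i)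
strip zero    {w = w} g0≢0 bw low eq = w , bw , eq
strip (suc m) {f} {g} {w} g0≢0 (e , bw) low eq =
  strip m g0≢0 (e , Below-tail (Below-weaken (ℕ.n≤1+n e) bw)) (λ i i<m → low (suc i) (s≤s i<m)) λ i →
    trans (eq (suc i)) (trans (cong (λ x → x * g (suc i) + (tail w ⊛ g) i) w0≡0) (ℤ.+-identityˡ _))
  where
  w0≡0 : w 0 ≡ + 0
  w0≡0 with ℤ.i*j≡0⇒i≡0∨j≡0 (w 0) (trans (sym (eq 0)) (low 0 (s≤s z≤n)))
  ... | inj₁ w0≡0 = w0≡0
  ... | inj₂ g0≡0 = ⊥-elim (g0≢0 g0≡0)

-- The Euler operator x d/dx.
θ : Seq → Seq
θ f i = + i * f i

-- With f = f(0) + x t one has x f′ = x (t + x t′).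
θ-tail : ∀ f → tail (θ f) ≗ tail f ⊕ θ (tail f)
θ-tail f i = trans (ℤ.*-distribʳ-+ (f (suc i)) (+ 1) (+ i)) (cong (_+ + i * f (suc i)) (ℤ.*-identityˡ (f (suc i))))

-- The Leibniz rule. Keeping the factor x in the operator leaves indices unshifted, so the induction
-- follows the recursion of `_⊛_`.
θ-⊛ : ∀ f g → θ (f ⊛ g) ≗ (θ f ⊛ g) ⊕ (f ⊛ θ g)
θ-⊛ f g zero    = sym (cong (_+_ (+ 0)) (ℤ.*-zeroʳ (f 0)))
θ-⊛ f g (suc n) = begin
  + suc n * (f 0 * g (suc n) + (tail f ⊛ g) n)
    ≡⟨ expand (+ n) (f 0) (g (suc n)) ((tail f ⊛ g) n) ⟩
  (tail f ⊛ g) n + + n * (tail f ⊛ g) n + f 0 * (+ suc n * g (suc n))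
    ≡⟨ cong (λ x → (tail f ⊛ g) n + x + f 0 * θ g (suc n)) (θ-⊛ (tail f) g n) ⟩
  (tail f ⊛ g) n + ((θ (tail f) ⊛ g) n + (tail f ⊛ θ g) n) + f 0 * θ g (suc n)
    ≡⟨ regroup ((tail f ⊛ g) n) ((θ (tail f) ⊛ g) n) ((tail f ⊛ θ g) n) (f 0 * θ g (suc n)) ⟩
  + 0 + ((tail f ⊛ g) n + (θ (tail f) ⊛ g) n) + (f 0 * θ g (suc n) + (tail f ⊛ θ g) n)
    ≡⟨ cong (λ x → + 0 + x + (f 0 * θ g (suc n) + (tail f ⊛ θ g) n))
         (trans (⊛-congʳ g (θ-tail f) n) (⊛-distribʳ g (tail f) (θ (tail f)) n)) ⟨
  + 0 * g (suc n) + (tail (θ f) ⊛ g) n + (f 0 * θ g (suc n) + (tail f ⊛ θ g) n) ∎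
  where
  open ≡-Reasoning
  expand : ∀ n a b x → (+ 1 + n) * (a * b + x) ≡ x + n * x + a * ((+ 1 + n) * b)
  expand = solve-∀
  regroup : ∀ x y z u → x + (y + z) + u ≡ + 0 + (x + y) + (u + z)
  regroup = solve-∀

Bounded-θ : ∀ {f} → Bounded f → Bounded (θ f)
Bounded-θ (d , b) = d , λ i d≤i → trans (cong (_*_ (+ i)) (b i d≤i)) (ℤ.*-zeroʳ (+ i))

Bounded-⊕ : ∀ {f g} → Bounded f → Bounded g → Bounded (f ⊕ g)
Bounded-⊕ (d , bf) (e , bg) = d ℕ.⊔ e , λ i le →
  cong₂ _+_ (bf i (ℕ.≤-trans (ℕ.m≤m⊔n d e) le)) (bg i (ℕ.≤-trans (ℕ.m≤n⊔m d e) le))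

-- By the Leibniz rule on g · (g w), both summands keep a factor g.
θ-square : ∀ {f g w} → Bounded g → Bounded w → f ≗ g ⊛ (g ⊛ w) → ∃ λ v → Bounded v × θ f ≗ v ⊛ g
θ-square {f} {g} {w} bg bw eq = v , bv , λ i → begin
  + i * f i                                      ≡⟨ cong (_*_ (+ i)) (eq i) ⟩
  θ (g ⊛ (g ⊛ w)) i                              ≡⟨ θ-⊛ g (g ⊛ w) i ⟩
  (θ g ⊛ (g ⊛ w)) i + (g ⊛ θ (g ⊛ w)) i          ≡⟨ cong₂ _+_ (swap i) (⊛-comm g (θ (g ⊛ w)) i) ⟩
  ((θ g ⊛ w) ⊛ g) i + (θ (g ⊛ w) ⊛ g) i          ≡⟨ ⊛-distribʳ g (θ g ⊛ w) (θ (g ⊛ w)) i ⟨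
  (v ⊛ g) i                                      ∎
  where
  open ≡-Reasoning
  v = (θ g ⊛ w) ⊕ θ (g ⊛ w)
  bv : Bounded v
  bv = Bounded-⊕ (Bounded-⊛ (Bounded-θ bg) bw) (Bounded-θ (Bounded-⊛ bg bw))
  swap : θ g ⊛ (g ⊛ w) ≗ (θ g ⊛ w) ⊛ g
  swap i = trans (⊛-congˡ (θ g) (⊛-comm g w) i) (sym (⊛-assoc (θ g) w g i))

mono-shift : ∀ m i c j → mono (m ℕ.+ i) c (m ℕ.+ j) ≡ mono i c j
mono-shift zero    i c j = refl
mono-shift (suc m) i c j = mono-shift m i c j

SquareFree : Seq → Set
SquareFree f = ∀ {d g w} → Monic (suc d) g → Bounded w → ¬ f ≗ g ⊛ (g ⊛ w)

-- A monic g with g² ∣ f divides x f′ = x^m (n x^j + s m), hence n x^j + s m as f(0) ≠ 0.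
-- Modulo n the latter is a constant, so the monic g forces n ∣ m.
Tri-squareFree : ∀ m j s c → 1 ≤ m → 1 ≤ j → ∣ s ∣ ≡ 1 → c ≢ + 0 → SquareFree (Tri (m ℕ.+ j) m s c)
Tri-squareFree m@(suc _) j@(suc _) s c 1≤m 1≤j ∣s∣≡1 c≢0 {d} {g} {w} mg bw eq
  with θ-square (suc (suc d) , proj₂ mg) bw eq
... | v , bv , θT≗vg with strip m g0≢0 bv low θT≗vg
  where
  g0≢0 : g 0 ≢ + 0
  g0≢0 z = c≢0 (trans (sym (trans (ℤ.+-identityˡ _) (ℤ.+-identityˡ c)))
                      (trans (eq 0) (cong (_* (g ⊛ w) 0) z)))
  low : ∀ i → i < m → θ (Tri (m ℕ.+ j) m s c) i ≡ + 0
  low zero    _   = refl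
  low (suc i) i<m = trans
    (cong (_*_ (+ suc i)) (cong₂ _+_
      (mono-off (m ℕ.+ j) (+ 1) (suc i) (λ e → ℕ.<⇒≢ (ℕ.<-≤-trans i<m (ℕ.m≤m+n m j)) (sym e)))
      (trans (ℤ.+-identityʳ _) (mono-off m s (suc i) (λ e → ℕ.<⇒≢ i<m (sym e))))))
    (ℤ.*-zeroʳ (+ suc i))
... | v′ , (e , bv′) , shifted =
  -- The constant term of n x^j + s m has absolute value m; divisible by n, it contradicts 0 < m <
  -- n.
  ℕ.<⇒≱ (ℕ.m<m+n m 1≤j) (ℕ.∣⇒≤ (subst (m ℕ.+ j ℕ.∣_) abs (∣⇒∣ᵤ n∣const)))
  where
  T = Tri (m ℕ.+ j) m s c
  T-shift : ∀ i → T (m ℕ.+ i) ≡ mono j (+ 1) i + mono 0 s i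
  T-shift i = cong₂ _+_ (mono-shift m j (+ 1) i)
    (trans (ℤ.+-identityʳ _) (trans (cong (λ k → mono k s (m ℕ.+ i)) (sym (ℕ.+-identityʳ m))) (mono-shift m 0 s i)))
  -- As g is nonconstant, index 0 is left out. Above it the only nonzero coefficient sits at `j`,
  -- where the factor that `θ` contributes is m + j = n.
  high : ∀ i → suc d ≤ i → + (m ℕ.+ j) ∣ (v′ ⊛ g) i
  high (suc i) _ = subst (+ (m ℕ.+ j) ∣_) (shifted (suc i))
    (subst (λ x → + (m ℕ.+ j) ∣ + (m ℕ.+ suc i) * x) (sym (T-shift (suc i))) (at (suc i ℕ.≟ j)))
    where
    at : Dec (suc i ≡ j) → + (m ℕ.+ j) ∣ + (m ℕ.+ suc i) * (mono j (+ 1) (suc i) + + 0)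
    at (yes refl) = ∣m⇒∣m*n {m = + (m ℕ.+ j)} (mono j (+ 1) j + + 0) (∣ᵤ⇒∣ ℕ.∣-refl)
    at (no i≢j)   = ∣n⇒∣m*n (+ (m ℕ.+ suc i))
      (subst (+ (m ℕ.+ j) ∣_) (sym (trans (ℤ.+-identityʳ _) (mono-off j (+ 1) (suc i) (i≢j ∘ sym)))) (∣0 _))
  n∣const : + (m ℕ.+ j) ∣ (v′ ⊛ g) 0
  n∣const = ∣-⊛ g (∣-monic-cancel e bv′ mg high) 0
  abs : ∣ (v′ ⊛ g) 0 ∣ ≡ m
  abs = begin
    ∣ (v′ ⊛ g) 0 ∣                     ≡⟨ cong ∣_∣ (shifted 0) ⟨
    ∣ + (m ℕ.+ 0) * T (m ℕ.+ 0) ∣      ≡⟨ cong (λ x → ∣ + (m ℕ.+ 0) * x ∣) (trans (T-shift 0) (ℤ.+-identityˡ s)) ⟩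
    ∣ + (m ℕ.+ 0) * s ∣                ≡⟨ ℤ.abs-* (+ (m ℕ.+ 0)) s ⟩
    (m ℕ.+ 0) ℕ.* ∣ s ∣                ≡⟨ cong₂ ℕ._*_ (ℕ.+-identityʳ m) ∣s∣≡1 ⟩
    m ℕ.* 1                            ≡⟨ ℕ.*-identityʳ m ⟩
    m                                  ∎
    where open ≡-Reasoning

-- Kronecker's factorisation algorithm

-- Horner's rule, cut off after N coefficients because a sequence carries no end of its own.
eval : ℕ → Seq → ℤ → ℤ
eval zero    f x = + 0
eval (suc N) f x = f 0 + x * eval N (tail f) x

eval-cong : ∀ N {f g} x → f ≗ g → eval N f x ≡ eval N g x
eval-cong zero    x eq = refl
eval-cong (suc N) x eq = cong₂ (λ a b → a + x * b) (eq 0) (eval-cong N x (eq ∘ suc))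

eval-𝟘 : ∀ N {f} x → f ≗ 𝟘 → eval N f x ≡ + 0
eval-𝟘 zero    x z = refl
eval-𝟘 (suc N) x z = trans (cong₂ (λ a b → a + x * b) (z 0) (eval-𝟘 N x (z ∘ suc)))
                           (trans (ℤ.+-identityˡ (x * + 0)) (ℤ.*-zeroʳ x))

eval-extend : ∀ {N M} f x → N ≤ M → Below N f → eval M f x ≡ eval N f x
eval-extend {M = M} f x z≤n b = eval-𝟘 M x (Below-0 b)
eval-extend f x (s≤s N≤M) b = cong (λ a → f 0 + x * a) (eval-extend (tail f) x N≤M (Below-tail b))

eval-⊕ : ∀ N f g x → eval N (f ⊕ g) x ≡ eval N f x + eval N g x
eval-⊕ zero    f g x = refl
eval-⊕ (suc N) f g x = trans (cong (λ a → f 0 + g 0 + x * a) (eval-⊕ N (tail f) (tail g) x))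
  (aux (f 0) (g 0) x (eval N (tail f) x) (eval N (tail g) x))
  where
  aux : ∀ a b x u v → a + b + x * (u + v) ≡ (a + x * u) + (b + x * v)
  aux = solve-∀

eval-· : ∀ N c f x → eval N (c · f) x ≡ c * eval N f x
eval-· zero    c f x = sym (ℤ.*-zeroʳ c)
eval-· (suc N) c f x = trans (cong (λ a → c * f 0 + x * a) (eval-· N c (tail f) x))
  (aux c (f 0) x (eval N (tail f) x))
  where
  aux : ∀ c a x u → c * a + x * (c * u) ≡ c * (a + x * u)
  aux = solve-∀

eval-⊛ : ∀ d {f e g} x → Below d f → Below e g → eval (d ℕ.+ e) (f ⊛ g) x ≡ eval d f x * eval e g x
eval-⊛ zero {f} {e} {g} x bf bg = eval-𝟘 e x (⊛-zeroˡ (Below-0 bf) g)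
eval-⊛ (suc d) {f} {e} {g} x bf bg = begin
  f 0 * g 0 + x * eval (d ℕ.+ e) ((f 0 · tail g) ⊕ (tail f ⊛ g)) x
    ≡⟨ cong (λ a → f 0 * g 0 + x * a) (begin
         eval (d ℕ.+ e) ((f 0 · tail g) ⊕ (tail f ⊛ g)) x
           ≡⟨ eval-⊕ (d ℕ.+ e) (f 0 · tail g) (tail f ⊛ g) x ⟩
         eval (d ℕ.+ e) (f 0 · tail g) x + eval (d ℕ.+ e) (tail f ⊛ g) x
           ≡⟨ cong₂ _+_ (eval-· (d ℕ.+ e) (f 0) (tail g) x) (eval-⊛ d x (Below-tail bf) bg) ⟩
         f 0 * eval (d ℕ.+ e) (tail g) x + eval d (tail f) x * eval e g x ∎) ⟩
  f 0 * g 0 + x * (f 0 * eval (d ℕ.+ e) (tail g) x + eval d (tail f) x * eval e g x)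
    ≡⟨ regroup (f 0) (g 0) x (eval (d ℕ.+ e) (tail g) x) (eval d (tail f) x) (eval e g x) ⟩
  f 0 * eval (suc (d ℕ.+ e)) g x + x * eval d (tail f) x * eval e g x
    ≡⟨ cong (λ a → f 0 * a + x * eval d (tail f) x * eval e g x)
         (eval-extend g x (ℕ.m≤n⇒m≤1+n (ℕ.m≤n+m e d)) bg) ⟩
  f 0 * eval e g x + x * eval d (tail f) x * eval e g x
    ≡⟨ ℤ.*-distribʳ-+ (eval e g x) (f 0) (x * eval d (tail f) x) ⟨
  (f 0 + x * eval d (tail f) x) * eval e g x ∎
  where
  open ≡-Reasoning
  regroup : ∀ a b x u v w → a * b + x * (a * u + v * w) ≡ a * (b + x * u) + x * v * w
  regroup = solve-∀

-- Synthetic division by x - a: each coefficient of the quotient is the value at a of a tail of f.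
-- `N` counts the coefficients of the quotient, one fewer than those of f.
quot : ℕ → Seq → ℤ → Seq
quot zero    f a _       = + 0
quot (suc N) f a zero    = eval (suc N) (tail f) a
quot (suc N) f a (suc i) = quot N (tail f) a i

quot-below : ∀ N f a → Below N (quot N f a)
quot-below zero    f a i       _         = refl
quot-below (suc N) f a (suc i) (s≤s N≤i) = quot-below N (tail f) a i N≤i

eval-quot : ∀ N f a x → eval (suc N) f x ≡ eval (suc N) f a + (x - a) * eval N (quot N f a) x
eval-quot zero f a x = aux (f 0) x a
  where
  aux : ∀ c x a → c + x * + 0 ≡ c + a * + 0 + (x - a) * + 0
  aux = solve-∀
eval-quot (suc N) f a x =
  trans (cong (λ y → f 0 + x * y) (eval-quot N (tail f) a x))
        (aux (f 0) x a (eval (suc N) (tail f) a) (eval N (quot N (tail f) a) x))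
  where
  aux : ∀ c x a u v → c + x * (u + (x - a) * v) ≡ c + a * u + (x - a) * (u + x * v)
  aux = solve-∀

-- The polynomial v + (x - a) q, which undoes division by x - a.
newton : ℤ → ℤ → Seq → Seq
newton v a q zero    = v - a * q 0
newton v a q (suc i) = q i - a * q (suc i)

newton-below : ∀ {N q} v a → Below N q → Below (suc N) (newton v a q)
newton-below v a b (suc i) (s≤s N≤i) =
  trans (cong₂ (λ y z → y - a * z) (b i N≤i) (b (suc i) (ℕ.m≤n⇒m≤1+n N≤i)))
        (aux a)
  where
  aux : ∀ a → + 0 - a * + 0 ≡ + 0
  aux = solve-∀

newton-cong : ∀ {v v′ q q′} a → v ≡ v′ → q ≗ q′ → newton v a q ≗ newton v′ a q′
newton-cong {v} a refl eq zero = cong (λ y → v - a * y) (eq 0)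
newton-cong a refl eq (suc i) = cong₂ (λ y z → y - a * z) (eq i) (eq (suc i))

newton-quot : ∀ N f a → Below (suc N) f → newton (eval (suc N) f a) a (quot N f a) ≗ f
newton-quot zero f a b zero    = aux (f 0) a
  where
  aux : ∀ c a → c + a * + 0 - a * + 0 ≡ c
  aux = solve-∀
newton-quot zero f a b (suc i) = trans (aux a) (sym (b (suc i) (s≤s z≤n)))
  where
  aux : ∀ a → + 0 - a * + 0 ≡ + 0
  aux = solve-∀
newton-quot (suc N) f a b zero = aux (f 0) (a * eval (suc N) (tail f) a)
  where
  aux : ∀ c y → c + y - y ≡ c
  aux = solve-∀
newton-quot (suc N) f a b (suc zero)    = newton-quot N (tail f) a (Below-tail b) zero
newton-quot (suc N) f a b (suc (suc i)) = newton-quot N (tail f) a (Below-tail b) (suc i)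

-- q(b) = (f(b) - f(a)) / (b - a), with a positive integer as denominator.
quot-bound : ∀ N f a b → a < b →
  ∣ eval N (quot N f (+ a)) (+ b) ∣ ≤ ∣ eval (suc N) f (+ b) ∣ ℕ.+ ∣ eval (suc N) f (+ a) ∣
quot-bound N f a b a<b with ℕ.m≤n⇒∃[o]m+o≡n a<b
... | o , refl = begin
  ∣ Q ∣               ≤⟨ ℕ.m≤n*m ∣ Q ∣ (suc o) ⟩
  suc o ℕ.* ∣ Q ∣     ≡⟨ ℤ.abs-* (+ suc o) Q ⟨
  ∣ + suc o * Q ∣     ≡⟨ cong ∣_∣ (isolate (+ a) (+ suc o) Q V U gap) ⟩
  ∣ V - U ∣           ≤⟨ ℤ.∣i-j∣≤∣i∣+∣j∣ V U ⟩
  ∣ V ∣ ℕ.+ ∣ U ∣     ∎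
  where
  open ℕ.≤-Reasoning
  Q = eval N (quot N f (+ a)) (+ b)
  V = eval (suc N) f (+ b)
  U = eval (suc N) f (+ a)
  gap : V ≡ U + (+ a + + suc o - + a) * Q
  gap = trans (eval-quot N f (+ a) (+ b)) (cong (λ y → U + (y - + a) * Q) (cong +_ (sym (ℕ.+-suc a o))))
  isolate : ∀ a s q v u → v ≡ u + (a + s - a) * q → s * q ≡ v - u
  isolate a s q v u eq = trans (aux a s q u) (cong (_- u) (sym eq))
    where
    aux : ∀ a s q u → s * q ≡ u + (a + s - a) * q - u
    aux = solve-∀

interval : ℕ → List ℤ
interval M = map +_ (upTo (suc M)) ++ map (λ i → - + i) (upTo (suc M))

∈-interval : ∀ {M} v → ∣ v ∣ ≤ M → v ∈ interval M
∈-interval (+ i)    le = ∈-++⁺ˡ (∈-map⁺ +_ (∈-upTo⁺ (s≤s le)))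
∈-interval {M} -[1+ i ] le = ∈-++⁺ʳ (map +_ (upTo (suc M))) (∈-map⁺ (λ i → - + i) (∈-upTo⁺ (s≤s le)))

-- Newton interpolation: a polynomial of degree < N with |f(b)| ≤ M b for b ≥ a is f(a) + (x − a) q, where
-- |q(b)| ≤ M b + M a for b > a because |b − a| ≥ 1. The list may contain further polynomials.
candidates : ∀ N → ℕ → (ℕ → ℕ) → List (∃ (Below N))
candidates zero    a M = (𝟘 , λ _ _ → refl) ∷ []
candidates (suc N) a M = cartesianProductWith
  (λ { v (q , b) → newton v (+ a) q , newton-below v (+ a) b })
  (interval (M a)) (candidates N (suc a) (λ b → M b ℕ.+ M a))

candidates-complete : ∀ N a M {f} → Below N f → (∀ b → a ≤ b → ∣ eval N f (+ b) ∣ ≤ M b) →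
  Any (λ c → proj₁ c ≗ f) (candidates N a M)
candidates-complete zero    a M b small = here (sym ∘ Below-0 b)
candidates-complete (suc N) a M {f} b small =
  cartesianProductWith⁺ _
    (λ v≡ q≗ i → trans (newton-cong (+ a) (sym v≡) q≗ i) (newton-quot N f (+ a) b i))
    (∈-interval (eval (suc N) f (+ a)) (small a ℕ.≤-refl))
    (candidates-complete N (suc a) (λ c → M c ℕ.+ M a) (quot-below N f (+ a)) λ c a<c →
      ℕ.≤-trans (quot-bound N f a c a<c)
        (ℕ.+-mono-≤ (small c (ℕ.<⇒≤ a<c)) (small a ℕ.≤-refl)))

-- f(b) ≡ f(0) modulo b, and b cannot divide a nonzero integer smaller than itself.
eval-≢0 : ∀ {N f} → f 0 ≢ + 0 → Below (suc N) f → ∀ b → ∣ f 0 ∣ < b → eval (suc N) f (+ b) ≢ + 0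
eval-≢0 {N} {f} f0≢0 bf b ∣f0∣<b eq = ℕ.<⇒≱ ∣f0∣<b (ℕ.∣⇒≤ ⦃ ℕ.≢-nonZero (f0≢0 ∘ ℤ.∣i∣≡0⇒i≡0) ⦄ b∣f0)
  where
  b∣f0 : b ℕ.∣ ∣ f 0 ∣
  b∣f0 = ∣⇒∣ᵤ (∣m+n∣n⇒∣m {+ b} {f 0} {+ b * eval N (tail f) (+ b)}
    (subst (+ b ∣_) (sym eq) (∣0 (+ b))) (∣m⇒∣m*n {m = + b} (eval N (tail f) (+ b)) (∣ᵤ⇒∣ ℕ.∣-refl)))

Const : Seq → Set
Const = Below 1

-- Constant factors, not only ±1, count as trivial: they become units over ℚ unless they vanish.
Irreducibleℤ : Seq → Set
Irreducibleℤ G = ∀ {A B} → Bounded A → Bounded B → G ≗ A ⊛ B → Const A ⊎ Const B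

-- The bound leaves finitely many coefficients to test; all decisions of the search rest on this.
vanishes? : ∀ {f} → Bounded f → Dec (f ≗ 𝟘)
vanishes? {f} (N , b) with ℕ.allUpTo? (λ i → f i ℤ.≟ + 0) N
... | no ¬z = no λ z → ¬z λ {i} _ → z i
... | yes z = yes λ i → case i (i ℕ.<? N)
  where
  case : ∀ i → Dec (i < N) → f i ≡ + 0
  case i (yes i<N) = z i<N
  case i (no i≮N)  = b i (ℕ.≮⇒≥ i≮N)

const? : ∀ {f} → Bounded f → Dec (Const f)
const? {f} (N , b) with vanishes? {tail f} (N , Below-tail (Below-weaken (ℕ.n≤1+n N) b))
... | yes z = yes λ { (suc i) _ → z i }
... | no ¬z = no λ c → ¬z λ i → c (suc i) (s≤s z≤n)

≗? : ∀ {f g} → Bounded f → Bounded g → Dec (f ≗ g)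
≗? {f} {g} (N , bf) (M , bg) with vanishes? {λ i → f i - g i} (N ℕ.⊔ M , λ i le →
  cong₂ _-_ (bf i (ℕ.≤-trans (ℕ.m≤m⊔n N M) le)) (bg i (ℕ.≤-trans (ℕ.m≤n⊔m N M) le)))
... | yes z = yes λ i → ℤ.i-j≡0⇒i≡j (f i) (g i) (z i)
... | no ¬z = no λ eq → ¬z λ i → ℤ.i≡j⇒i-j≡0 (eq i)

Splitting : Seq → Seq → Seq → Set
Splitting G A B = ¬ Const A × ¬ Const B × G ≗ A ⊛ B

Splitting-resp : ∀ {G A A′ B B′} → A ≗ A′ → B ≗ B′ → Splitting G A′ B′ → Splitting G A B
Splitting-resp a b (¬cA , ¬cB , eq) =
  ¬cA ∘ Below-resp a , ¬cB ∘ Below-resp b , λ i → trans (eq i) (sym (⊛-cong a b i))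

splitting? : ∀ {G A B} → Bounded G → Bounded A → Bounded B → Dec (Splitting G A B)
splitting? bG bA bB = ¬? (const? bA) ×-dec (¬? (const? bB) ×-dec ≗? bG (Bounded-⊛ bA bB))

factor-value : ∀ {N G A B b} → Below N G → Below N A → Below N B → G ≗ A ⊛ B →
  eval N G (+ b) ≢ + 0 → ∣ eval N A (+ b) ∣ ≤ ∣ eval N G (+ b) ∣
factor-value {N} {G} {A} {B} {b} bG bA bB eq G≢0 =
  ℕ.∣⇒≤ ⦃ ℕ.≢-nonZero (G≢0 ∘ ℤ.∣i∣≡0⇒i≡0) ⦄ (∣⇒∣ᵤ (divides (eval N B (+ b)) (begin
    eval N G (+ b)                     ≡⟨ eval-extend G (+ b) (ℕ.m≤m+n N N) bG ⟨
    eval (N ℕ.+ N) G (+ b)             ≡⟨ eval-cong (N ℕ.+ N) (+ b) eq ⟩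
    eval (N ℕ.+ N) (A ⊛ B) (+ b)       ≡⟨ eval-⊛ N (+ b) bA bB ⟩
    eval N A (+ b) * eval N B (+ b)    ≡⟨ ℤ.*-comm (eval N A (+ b)) _ ⟩
    eval N B (+ b) * eval N A (+ b)    ∎)))
  where open ≡-Reasoning

unscale : ∀ s {d f} → s * s ≡ + 1 → Below d (s · f) → Below d f
unscale s {f = f} ss≡1 b i d≤i = begin
  f i             ≡⟨ ℤ.*-identityˡ (f i) ⟨
  + 1 * f i       ≡⟨ cong (_* f i) ss≡1 ⟨
  s * s * f i     ≡⟨ ℤ.*-assoc s s (f i) ⟩
  s * (s * f i)   ≡⟨ cong (s *_) (b i d≤i) ⟩
  s * + 0         ≡⟨ ℤ.*-zeroʳ s ⟩
  + 0             ∎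
  where open ≡-Reasoning

record MonicSplitting (n : ℕ) (G : Seq) : Set where
  field
    {dA dB} : ℕ
    {A B}   : Seq
    monicA  : Monic (suc dA) A
    monicB  : Monic (suc dB) B
    degrees : suc dA ℕ.+ suc dB ≡ n
    splits  : G ≗ A ⊛ B

monic-splitting : ∀ {n G A B} → Monic n G → Bounded A → Bounded B → Splitting G A B → MonicSplitting n G
monic-splitting mG bA bB (¬cA , ¬cB , eq) with monic-factors mG bA bB eq
... | zero  , _     , s , _ , ss , mA , _  , _ = ⊥-elim (¬cA (unscale s ss (proj₂ mA)))
... | suc _ , zero  , s , _ , ss , _  , mB , _ = ⊥-elim (¬cB (unscale s ss (proj₂ mB)))
... | suc _ , suc _ , s , de , ss , mA , mB , eq′ =
  record { monicA = mA ; monicB = mB ; degrees = de ; splits = eq′ }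

-- A factor of G takes at b a value dividing G(b), which is nonzero once b > |G(0)|.
split-or-irreducible : ∀ {n G} → Monic n G → G 0 ≢ + 0 → MonicSplitting n G ⊎ Irreducibleℤ G
split-or-irreducible {n} {G} mG G0≢0
  with any? (λ A → any? (λ B → splitting? bG (bounded A) (bounded B)) cs) cs
  where
  bG : Bounded G
  bG = suc n , proj₂ mG
  bounded : (A : ∃ (Below (suc n))) → Bounded (proj₁ A)
  bounded (A , b) = suc n , b
  cs : List (∃ (Below (suc n)))
  cs = candidates (suc n) (suc ∣ G 0 ∣) (λ b → ∣ eval (suc n) G (+ b) ∣)
... | yes found with Any.satisfied found
... | (A , bA) , found′ with Any.satisfied found′
... | (B , bB) , s = inj₁ (monic-splitting mG (suc n , bA) (suc n , bB) s)
split-or-irreducible {n} {G} mG G0≢0 | no none = inj₂ irreducible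
  where
  complete : ∀ {A B} → Below (suc n) A → Below (suc n) B → G ≗ A ⊛ B →
    Any (λ c → proj₁ c ≗ A) (candidates (suc n) (suc ∣ G 0 ∣) (λ b → ∣ eval (suc n) G (+ b) ∣))
  complete {A} {B} bA bB eq = candidates-complete (suc n) (suc ∣ G 0 ∣) _ bA λ b G0<b →
    factor-value (proj₂ mG) bA bB eq (eval-≢0 G0≢0 (proj₂ mG) b G0<b)
  irreducible : Irreducibleℤ G
  irreducible {A} {B} bA bB eq with const? bA | const? bB
  ... | yes cA | _      = inj₁ cA
  ... | no _   | yes cB = inj₂ cB
  ... | no ¬cA | no ¬cB with monic-factors mG bA bB eq
  ... | d , e , s , d+e≡n , ss≡1 , mA , mB , _ =
    -- The list contains A and B only up to pointwise equality, so the splitting is transported to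
    -- its entries.
    ⊥-elim (none (Any.map (λ c≗A → Any.map (λ c≗B → Splitting-resp c≗A c≗B (¬cA , ¬cB , eq)) foundB) foundA))
    where
    -- The degrees add to n, so both factors are within reach of the search, whatever bounds they
    -- came with.
    bA′ : Below (suc n) A
    bA′ = unscale s ss≡1 (Below-weaken (s≤s (subst (d ≤_) d+e≡n (ℕ.m≤m+n d e))) (proj₂ mA))
    bB′ : Below (suc n) B
    bB′ = unscale s ss≡1 (Below-weaken (s≤s (subst (e ≤_) d+e≡n (ℕ.m≤n+m e d))) (proj₂ mB))
    foundA = complete bA′ bB′ eq
    foundB = complete bB′ bA′ λ i → trans (eq i) (⊛-comm A B i)

-- Complete factorisation into monic irreducibles over ℤ

-- The number stored with a factor is its degree minus one, so listed factors are nonconstant by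
-- construction.
Factor : ℕ × Seq → Set
Factor (d , g) = Monic (suc d) g × Irreducibleℤ g

∏ : List (ℕ × Seq) → Seq
∏ []             = 𝟙
∏ ((_ , g) ∷ gs) = g ⊛ ∏ gs

∏-++ : ∀ gs hs → ∏ (gs ++ hs) ≗ ∏ gs ⊛ ∏ hs
∏-++ []             hs i = sym (⊛-identityˡ (∏ hs) i)
∏-++ ((_ , g) ∷ gs) hs i = trans (⊛-congˡ g (∏-++ gs hs) i) (sym (⊛-assoc g (∏ gs) (∏ hs) i))

-- Both parts of a splitting have positive degree, hence smaller degree than G, so fuel equal to the
-- degree suffices.
factor : ∀ fuel {n G} → n ≤ fuel → Monic n G → G 0 ≢ + 0 → ∃ λ gs → All Factor gs × G ≗ ∏ gs
factor _ {zero} {G} _ (G0≡1 , b) _ = [] , [] , λ { zero → G0≡1 ; (suc i) → b (suc i) (s≤s z≤n) }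
factor (suc fuel) {suc n} {G} (s≤s n≤fuel) mG G0≢0 with split-or-irreducible mG G0≢0
... | inj₂ irr = (n , G) ∷ [] , (mG , irr) ∷ [] , λ i → sym (⊛-identityʳ G i)
... | inj₁ S with factor fuel dA≤ monicA A0≢0 | factor fuel dB≤ monicB B0≢0
  where
  open MonicSplitting S
  dA≤ : suc dA ≤ fuel
  dA≤ = ℕ.≤-trans (ℕ.m≤m+n (suc dA) dB)
    (ℕ.≤-trans (ℕ.≤-reflexive (ℕ.suc-injective (trans (sym (ℕ.+-suc (suc dA) dB)) degrees))) n≤fuel)
  dB≤ : suc dB ≤ fuel
  dB≤ = ℕ.≤-trans (ℕ.m≤n+m (suc dB) dA) (ℕ.≤-trans (ℕ.≤-reflexive (ℕ.suc-injective degrees)) n≤fuel)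
  A0≢0 : A 0 ≢ + 0
  A0≢0 z = G0≢0 (trans (splits 0) (cong (_* B 0) z))
  B0≢0 : B 0 ≢ + 0
  B0≢0 z = G0≢0 (trans (splits 0) (trans (cong (A 0 *_) z) (ℤ.*-zeroʳ (A 0))))
... | gs , fg , eqA | hs , fh , eqB = gs ++ hs , All.++⁺ fg fh , λ i →
  trans (MonicSplitting.splits S i) (trans (⊛-cong eqA eqB i) (sym (∏-++ gs hs i)))

-- Passage to ℚ

ι-* : ∀ x y → ι x ℚ.* ι y ≡ ι (x * y)
ι-* x y = ℚ.↥p/↧p≡p (ι (x * y))

ι-+ : ∀ x y → ι x ℚ.+ ι y ≡ ι (x + y)
ι-+ x y = trans (cong₂ (λ a b → (a + b) ℚ./ 1) (ℤ.*-identityʳ x) (ℤ.*-identityʳ y)) (ℚ.↥p/↧p≡p (ι (x + y)))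

ι-injective : ∀ {x y} → ι x ≡ ι y → x ≡ y
ι-injective = cong ℚ.↥_

*-denominator : ∀ p → p ℚ.* ι (ℚ.↧ p) ≡ ι (ℚ.↥ p)
*-denominator p@(ℚ.mkℚ n d _) = ℚ.toℚᵘ-injective (ℚᵘ.≃-trans (ℚ.toℚᵘ-homo-* p (ι (+ suc d)))
  (ℚᵘ.*≡* (trans (ℤ.*-identityʳ _) (cong (λ k → n * + k) (sym (ℕ.*-identityʳ (suc d)))))))

ι-cancel : ∀ {x α} → α ≢ + 0 → x ℚ.* ι α ≡ ℚ.0ℚ → x ≡ ℚ.0ℚ
ι-cancel {x} {α} α≢0 eq with ℤ.i*j≡0⇒i≡0∨j≡0 (ℚ.↥ x) (ι-injective (begin
  ι (ℚ.↥ x * α)                      ≡⟨ ι-* (ℚ.↥ x) α ⟨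
  ι (ℚ.↥ x) ℚ.* ι α                  ≡⟨ cong (ℚ._* ι α) (*-denominator x) ⟨
  x ℚ.* ι (ℚ.↧ x) ℚ.* ι α            ≡⟨ xy∙z≈xz∙y x (ι (ℚ.↧ x)) (ι α) ⟩
  x ℚ.* ι α ℚ.* ι (ℚ.↧ x)            ≡⟨ cong (ℚ._* ι (ℚ.↧ x)) eq ⟩
  ℚ.0ℚ ℚ.* ι (ℚ.↧ x)                 ≡⟨ ℚ.*-zeroˡ (ι (ℚ.↧ x)) ⟩
  ι (+ 0)                            ∎))
  where open ≡-Reasoning
... | inj₁ n≡0 = ℚ.↥p≡0⇒p≡0 x n≡0
... | inj₂ α≡0 = ⊥-elim (α≢0 α≡0)

coeff-+ : ∀ p q i → coeff (p +ₚ q) i ≡ coeff p i ℚ.+ coeff q i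
coeff-+ []      q       i       = sym (ℚ.+-identityˡ (coeff q i))
coeff-+ (a ∷ p) []      i       = sym (ℚ.+-identityʳ (coeff (a ∷ p) i))
coeff-+ (a ∷ p) (b ∷ q) zero    = refl
coeff-+ (a ∷ p) (b ∷ q) (suc i) = coeff-+ p q i

coeff-scale : ∀ c p i → coeff (scale c p) i ≡ c ℚ.* coeff p i
coeff-scale c []      i       = sym (ℚ.*-zeroʳ c)
coeff-scale c (a ∷ p) zero    = refl
coeff-scale c (a ∷ p) (suc i) = coeff-scale c p i

-- A is α p, with α in the role of a common denominator; stated by multiplication so that nothing is
-- divided in ℚ.
Represents : ℤ → Poly → Seq → Set
Represents α p A = ∀ i → coeff p i ℚ.* ι α ≡ ι (A i)

Represents-* : ∀ {α β} p q {A B} → Represents α p A → Represents β q B → Represents (α * β) (p *ₚ q) (A ⊛ B)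
Represents-* {α} {β} [] q {A} {B} rp rq i = trans (ℚ.*-zeroˡ (ι (α * β))) (cong ι (sym (⊛-zeroˡ A≗𝟘 B i)))
  where
  A≗𝟘 : A ≗ 𝟘
  A≗𝟘 j = ι-injective (trans (sym (rp j)) (ℚ.*-zeroˡ (ι α)))
Represents-* {α} {β} (a ∷ p) q {A} {B} rp rq = represents
  where
  open ≡-Reasoning
  head-term : ∀ i → a ℚ.* coeff q i ℚ.* ι (α * β) ≡ ι (A 0 * B i)
  head-term i = begin
    a ℚ.* coeff q i ℚ.* ι (α * β)           ≡⟨ cong (a ℚ.* coeff q i ℚ.*_) (ι-* α β) ⟨
    a ℚ.* coeff q i ℚ.* (ι α ℚ.* ι β)       ≡⟨ interchange a (coeff q i) (ι α) (ι β) ⟩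
    a ℚ.* ι α ℚ.* (coeff q i ℚ.* ι β)       ≡⟨ cong₂ ℚ._*_ (rp 0) (rq i) ⟩
    ι (A 0) ℚ.* ι (B i)                     ≡⟨ ι-* (A 0) (B i) ⟩
    ι (A 0 * B i)                           ∎
  step : ∀ i {x} → x ≡ coeff (ℚ.0ℚ ∷ (p *ₚ q)) i →
    coeff (scale a q +ₚ (ℚ.0ℚ ∷ (p *ₚ q))) i ℚ.* ι (α * β) ≡ ι (A 0 * B i) ℚ.+ x ℚ.* ι (α * β)
  step i {x} eq = begin
    coeff (scale a q +ₚ (ℚ.0ℚ ∷ (p *ₚ q))) i ℚ.* ι (α * β)
      ≡⟨ cong (ℚ._* ι (α * β)) (trans (coeff-+ (scale a q) _ i) (cong₂ ℚ._+_ (coeff-scale a q i) (sym eq))) ⟩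
    (a ℚ.* coeff q i ℚ.+ x) ℚ.* ι (α * β)
      ≡⟨ ℚ.*-distribʳ-+ (ι (α * β)) (a ℚ.* coeff q i) x ⟩
    a ℚ.* coeff q i ℚ.* ι (α * β) ℚ.+ x ℚ.* ι (α * β)
      ≡⟨ cong (ℚ._+ x ℚ.* ι (α * β)) (head-term i) ⟩
    ι (A 0 * B i) ℚ.+ x ℚ.* ι (α * β) ∎
  represents : Represents (α * β) ((a ∷ p) *ₚ q) (A ⊛ B)
  represents zero    = trans (step 0 refl)
    (trans (cong (ι (A 0 * B 0) ℚ.+_) (ℚ.*-zeroˡ (ι (α * β)))) (ℚ.+-identityʳ _))
  represents (suc i) = trans (step (suc i) refl)
    (trans (cong (ι (A 0 * B (suc i)) ℚ.+_) (Represents-* p q (λ j → rp (suc j)) rq i))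
           (ι-+ (A 0 * B (suc i)) ((tail A ⊛ B) i)))

Represents₁ : ∀ {p A} → Represents (+ 1) p A → ∀ i → coeff p i ≡ ι (A i)
Represents₁ {p} rp i = trans (sym (ℚ.*-identityʳ (coeff p i))) (rp i)

represents₁ : ∀ {p A} → (∀ i → coeff p i ≡ ι (A i)) → Represents (+ 1) p A
represents₁ {p} eq i = trans (ℚ.*-identityʳ (coeff p i)) (eq i)

toPoly : ℕ → Seq → Poly
toPoly zero    f = []
toPoly (suc N) f = ι (f 0) ∷ toPoly N (tail f)

coeff-toPoly : ∀ {N f} → Below N f → ∀ i → coeff (toPoly N f) i ≡ ι (f i)
coeff-toPoly {zero}  b i       = cong ι (sym (Below-0 b i))
coeff-toPoly {suc N} b zero    = refl
coeff-toPoly {suc N} b (suc i) = coeff-toPoly (Below-tail b) i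

clear-denominators : ∀ p → ∃₂ λ α A → Bounded A × Represents (+ suc α) p A
clear-denominators [] = 0 , 𝟘 , (0 , λ _ _ → refl) , λ _ → refl
clear-denominators (a@(ℚ.mkℚ num δ _) ∷ p) with clear-denominators p
-- The successor of this number computes to `suc α * suc δ`, the old common denominator times that
-- of the new coefficient.
... | α , A , (d , b) , rp = δ ℕ.+ α ℕ.* suc δ , A′ , (suc d , b′) , rp′
  where
  open ≡-Reasoning
  A′ : Seq
  A′ zero    = num * + suc α
  A′ (suc i) = A i * + suc δ
  b′ : Below (suc d) A′
  b′ (suc i) (s≤s d≤i) = cong (_* + suc δ) (b i d≤i)
  rp′ : Represents (+ suc α * + suc δ) (a ∷ p) A′
  rp′ zero = begin
    a ℚ.* ι (+ suc α * + suc δ)             ≡⟨ cong (a ℚ.*_) (ι-* (+ suc α) (+ suc δ)) ⟨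
    a ℚ.* (ι (+ suc α) ℚ.* ι (+ suc δ))     ≡⟨ x∙yz≈xz∙y a (ι (+ suc α)) (ι (+ suc δ)) ⟩
    a ℚ.* ι (+ suc δ) ℚ.* ι (+ suc α)       ≡⟨ cong (ℚ._* ι (+ suc α)) (*-denominator a) ⟩
    ι num ℚ.* ι (+ suc α)                   ≡⟨ ι-* num (+ suc α) ⟩
    ι (num * + suc α)                       ∎
  rp′ (suc i) = begin
    coeff p i ℚ.* ι (+ suc α * + suc δ)             ≡⟨ cong (coeff p i ℚ.*_) (ι-* (+ suc α) (+ suc δ)) ⟨
    coeff p i ℚ.* (ι (+ suc α) ℚ.* ι (+ suc δ))     ≡⟨ ℚ.*-assoc (coeff p i) (ι (+ suc α)) (ι (+ suc δ)) ⟨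
    coeff p i ℚ.* ι (+ suc α) ℚ.* ι (+ suc δ)       ≡⟨ cong (ℚ._* ι (+ suc δ)) (rp i) ⟩
    ι (A i) ℚ.* ι (+ suc δ)                         ≡⟨ ι-* (A i) (+ suc δ) ⟩
    ι (A i * + suc δ)                               ∎

-- Gauss's lemma

-- Polynomials modulo q form an integral domain. A constant term divisible by q is dropped from its
-- factor; if neither is divisible, Euclid's lemma contradicts divisibility of their product.
prime-∣-⊛ : ∀ {q} → Prime q → ∀ d e {A B} → Below d A → Below e B →
  (∀ i → + q ∣ (A ⊛ B) i) → (∀ i → + q ∣ A i) ⊎ (∀ i → + q ∣ B i)
prime-∣-⊛ {q} pq zero e bA bB h = inj₁ λ i → subst (+ q ∣_) (sym (Below-0 bA i)) (∣0 (+ q))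
prime-∣-⊛ {q} pq (suc d) zero bA bB h = inj₂ λ i → subst (+ q ∣_) (sym (Below-0 bB i)) (∣0 (+ q))
prime-∣-⊛ {q} pq (suc d) (suc e) {A} {B} bA bB h with + q ∣? A 0 | + q ∣? B 0
... | yes q∣A0 | _ with prime-∣-⊛ pq d (suc e) (Below-tail bA) bB
        (λ i → ∣m+n∣m⇒∣n (h (suc i)) (∣m⇒∣m*n (B (suc i)) q∣A0))
...   | inj₁ q∣A = inj₁ λ { zero → q∣A0 ; (suc i) → q∣A i }
...   | inj₂ q∣B = inj₂ q∣B
prime-∣-⊛ {q} pq (suc d) (suc e) {A} {B} bA bB h | no _ | yes q∣B0
  with prime-∣-⊛ pq (suc d) e bA (Below-tail bB)
        (λ i → ∣m+n∣m⇒∣n (subst (+ q ∣_) (⊛-sucʳ A B i) (h (suc i))) (∣n⇒∣m*n (A (suc i)) q∣B0))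
...   | inj₁ q∣A = inj₁ q∣A
...   | inj₂ q∣B = inj₂ λ { zero → q∣B0 ; (suc i) → q∣B i }
prime-∣-⊛ {q} pq (suc d) (suc e) {A} {B} bA bB h | no q∤A0 | no q∤B0
  with euclidsLemma ∣ A 0 ∣ ∣ B 0 ∣ pq (subst (q ℕ.∣_) (ℤ.abs-* (A 0) (B 0)) (∣⇒∣ᵤ (h 0)))
...   | inj₁ q∣A0 = ⊥-elim (q∤A0 (∣ᵤ⇒∣ q∣A0))
...   | inj₂ q∣B0 = ⊥-elim (q∤B0 (∣ᵤ⇒∣ q∣B0))

·-cancel : ∀ q .⦃ _ : ℕ.NonZero q ⦄ {f g} → (+ q) · f ≗ (+ q) · g → f ≗ g
·-cancel (suc q) {f} {g} eq i = ℤ.*-cancelˡ-≡ (+ suc q) (f i) (g i) (eq i)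

divide-out : ∀ {q A} → Prime q → Bounded A → (∀ i → + q ∣ A i) →
  ∃ λ A₁ → Bounded A₁ × A ≗ (+ q) · A₁
divide-out {q} {A} pq (d , b) h = (λ i → quotient (h i)) , (d , b₁) , A≗
  where
  A≗ : A ≗ (+ q) · (λ i → quotient (h i))
  A≗ i = trans (_∣_.equality (h i)) (ℤ.*-comm (quotient (h i)) (+ q))
  b₁ : Below d (λ i → quotient (h i))
  b₁ i d≤i with ℤ.i*j≡0⇒i≡0∨j≡0 (+ q) (trans (sym (A≗ i)) (b i d≤i))
  ... | inj₁ q≡0 = ⊥-elim (ℕ.≢-nonZero⁻¹ q ⦃ prime⇒nonZero pq ⦄ (ℤ.+-injective q≡0))
  ... | inj₂ z   = z

·-const : ∀ c {A A₁} → A ≗ c · A₁ → Const A₁ → Const A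
·-const c eq k i 1≤i = trans (eq i) (trans (cong (c *_) (k i 1≤i)) (ℤ.*-zeroʳ c))

-- Each prime of the integer multiplier divides all of A or all of B and is cancelled there. The
-- maps between `Const` carry a verdict on the reduced factors back to the original ones.
gauss : ∀ qs → All Prime qs → ∀ {G A B} → Bounded A → Bounded B → (+ product qs) · G ≗ A ⊛ B →
  ∃₂ λ A′ B′ → Bounded A′ × Bounded B′ × G ≗ A′ ⊛ B′ × (Const A′ → Const A) × (Const B′ → Const B)
gauss [] [] {G} {A} {B} bA bB eq =
  A , B , bA , bB , (λ i → trans (sym (ℤ.*-identityˡ (G i))) (eq i)) , (λ k → k) , (λ k → k)
gauss (q ∷ qs) (pq ∷ pqs) {G} {A} {B} bA@(d , bA′) bB@(e , bB′) eq
  with prime-∣-⊛ pq d e bA′ bB′ (λ i → divides (+ product qs * G i) (trans (sym (eq i)) (reassoc i)))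
  where
  reassoc : ∀ i → + (q ℕ.* product qs) * G i ≡ + product qs * G i * + q
  reassoc i = trans (cong (_* G i) (ℤ.pos-* q (product qs))) (aux (+ q) (+ product qs) (G i))
    where
    aux : ∀ a b c → a * b * c ≡ b * c * a
    aux = solve-∀
... | inj₁ q∣A with divide-out pq bA q∣A
...   | A₁ , bA₁ , A≗ with gauss qs pqs bA₁ bB (·-cancel q ⦃ prime⇒nonZero pq ⦄ λ i → begin
          + q * (+ product qs * G i)   ≡⟨ ℤ.*-assoc (+ q) (+ product qs) (G i) ⟨
          + q * + product qs * G i     ≡⟨ cong (_* G i) (ℤ.pos-* q (product qs)) ⟨
          + product (q ∷ qs) * G i     ≡⟨ eq i ⟩
          (A ⊛ B) i                    ≡⟨ ⊛-congʳ B A≗ i ⟩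
          (((+ q) · A₁) ⊛ B) i         ≡⟨ ·-⊛ (+ q) A₁ B i ⟩
          + q * (A₁ ⊛ B) i             ∎)
  where open ≡-Reasoning
...     | A′ , B′ , bA″ , bB″ , eq′ , cA , cB = A′ , B′ , bA″ , bB″ , eq′ , ·-const (+ q) A≗ ∘ cA , cB
gauss (q ∷ qs) (pq ∷ pqs) {G} {A} {B} bA bB eq | inj₂ q∣B with divide-out pq bB q∣B
...   | B₁ , bB₁ , B≗ with gauss qs pqs bA bB₁ (·-cancel q ⦃ prime⇒nonZero pq ⦄ λ i → begin
          + q * (+ product qs * G i)   ≡⟨ ℤ.*-assoc (+ q) (+ product qs) (G i) ⟨
          + q * + product qs * G i     ≡⟨ cong (_* G i) (ℤ.pos-* q (product qs)) ⟨
          + product (q ∷ qs) * G i     ≡⟨ eq i ⟩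
          (A ⊛ B) i                    ≡⟨ ⊛-congˡ A B≗ i ⟩
          (A ⊛ ((+ q) · B₁)) i         ≡⟨ ⊛-· (+ q) A B₁ i ⟩
          + q * (A ⊛ B₁) i             ∎)
  where open ≡-Reasoning
...     | A′ , B′ , bA″ , bB″ , eq′ , cA , cB = A′ , B′ , bA″ , bB″ , eq′ , cA , ·-const (+ q) B≗ ∘ cB

const⇒unit : ∀ {α p A} → α ≢ + 0 → Represents α p A → Const A → ¬ A ≗ 𝟘 → IsUnit p
const⇒unit {α} {p} {A} α≢0 rp cA A≢𝟘 = coeff p 0 , p0≢0 , p≈
  where
  higher : ∀ i → coeff p (suc i) ≡ ℚ.0ℚ
  higher i = ι-cancel α≢0 (trans (rp (suc i)) (cong ι (cA (suc i) (s≤s z≤n))))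
  p≈ : p ≈ₚ (coeff p 0 ∷ [])
  p≈ zero    = refl
  p≈ (suc i) = higher i
  p0≢0 : coeff p 0 ≢ ℚ.0ℚ
  p0≢0 z = A≢𝟘 λ
    { zero    → ι-injective (trans (sym (rp 0)) (trans (cong (ℚ._* ι α) z) (ℚ.*-zeroˡ (ι α))))
    ; (suc i) → cA (suc i) (s≤s z≤n) }

irreducible : ∀ {d G} g → Monic (suc d) G → Irreducibleℤ G → (∀ i → coeff g i ≡ ι (G i)) → Irreducible g
irreducible {d} {G} g mG irr rep = not-zero , not-unit , no-factors
  where
  top≢0 : coeff g (suc d) ≢ ℚ.0ℚ
  top≢0 z = proj₁ (Monic⇒HasDeg mG) (ι-injective (trans (sym (rep (suc d))) z))
  not-zero : ¬ IsZero g
  not-zero z = top≢0 (z (suc d))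
  not-unit : ¬ IsUnit g
  not-unit (_ , _ , eq) = top≢0 (eq (suc d))
  no-factors : ∀ a b → g ≈ₚ (a *ₚ b) → IsUnit a ⊎ IsUnit b
  no-factors a b eq with clear-denominators a | clear-denominators b
  ... | α , A , bA , ra | β , B , bB , rb = conclude
    where
    open ≡-Reasoning
    -- Multiplying g = a b by both common denominators gives an identity over ℤ, and the primes of
    -- `N` are what `gauss` removes.
    N = suc α ℕ.* suc β
    NG≗AB : (+ N) · G ≗ A ⊛ B
    NG≗AB i = ι-injective (begin
      ι (+ N * G i)              ≡⟨ ι-* (+ N) (G i) ⟨
      ι (+ N) ℚ.* ι (G i)        ≡⟨ ℚ.*-comm (ι (+ N)) (ι (G i)) ⟩
      ι (G i) ℚ.* ι (+ N)        ≡⟨ cong (ℚ._* ι (+ N)) (trans (sym (rep i)) (eq i)) ⟩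
      coeff (a *ₚ b) i ℚ.* ι (+ N) ≡⟨ Represents-* {+ suc α} {+ suc β} a b ra rb i ⟩
      ι ((A ⊛ B) i)              ∎)
    NGtop≢0 : + N * G (suc d) ≢ + 0
    NGtop≢0 = *-≢0 {+ N} (λ ()) (proj₁ (Monic⇒HasDeg mG))
    A≢𝟘 : ¬ A ≗ 𝟘
    A≢𝟘 z = NGtop≢0 (trans (NG≗AB (suc d)) (⊛-zeroˡ z B (suc d)))
    B≢𝟘 : ¬ B ≗ 𝟘
    B≢𝟘 z = NGtop≢0 (trans (NG≗AB (suc d)) (trans (⊛-comm A B (suc d)) (⊛-zeroˡ z A (suc d))))
    open PrimeFactorisation (factorise N)
    conclude : IsUnit a ⊎ IsUnit b
    conclude
      with _ , _ , bA′ , bB′ , G≗ , constA , constB ← gauss factors factorsPrime bA bB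
             (λ i → trans (cong (λ k → + k * G i) (sym isFactorisation)) (NG≗AB i))
      with irr bA′ bB′ G≗
    ... | inj₁ c = inj₁ (const⇒unit {+ suc α} {a} (λ ()) ra (constA c) A≢𝟘)
    ... | inj₂ c = inj₂ (const⇒unit {+ suc β} {b} (λ ()) rb (constB c) B≢𝟘)

-- Reciprocal and associated monic polynomials

-- A nonzero coefficient s means that the list reaches index s, so the truncation ends exactly there
-- and its reversal starts there.
coeff-reverse-take : ∀ s p → coeff p s ≢ ℚ.0ℚ → coeff (reverse (take (suc s) p)) 0 ≡ coeff p s
coeff-reverse-take s p ps≢0 with take-suc s p ps≢0
  where
  take-suc : ∀ s p → coeff p s ≢ ℚ.0ℚ → take (suc s) p ≡ take s p ++ coeff p s ∷ []
  take-suc s       []      ps≢0 = ⊥-elim (ps≢0 refl)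
  take-suc zero    (a ∷ p) ps≢0 = refl
  take-suc (suc s) (a ∷ p) ps≢0 = cong (a ∷_) (take-suc s p ps≢0)
... | eq = trans (cong (λ l → coeff (reverse l) 0) eq)
                 (cong (λ l → coeff l 0) (reverse-++ (take s p) (coeff p s ∷ [])))

-- The constant term of x^s g(1/x) is the leading coefficient 1; reciprocity would equate it with ±
-- g(0).
nonReciprocal : ∀ {d G} g → Monic d G → G 0 ≢ + 0 → G 0 * G 0 ≢ + 1 →
  (∀ i → coeff g i ≡ ι (G i)) → NonReciprocal g
nonReciprocal {d} {G} g mG G0≢0 G0²≢1 rep = g0≢0 , not-reciprocal
  where
  g0≢0 : coeff g 0 ≢ ℚ.0ℚ
  g0≢0 z = G0≢0 (ι-injective (trans (sym (rep 0)) z))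
  not-reciprocal : ¬ Reciprocal g
  not-reciprocal (s , (gs≢0 , above) , _ , sym-or-antisym) = conclude sym-or-antisym
    where
    s≡d : s ≡ d
    s≡d = HasDeg-unique
      ((λ z → gs≢0 (trans (rep s) (cong ι z))) , λ i s<i → ι-injective (trans (sym (rep i)) (above i s<i)))
      (Monic⇒HasDeg mG)
    lead : coeff (reciprocalPoly g s) 0 ≡ ι (+ 1)
    lead = trans (coeff-reverse-take s g gs≢0) (trans (rep s) (cong ι (trans (cong G s≡d) (proj₁ mG))))
    conclude : ¬ (reciprocalPoly g s ≈ₚ g ⊎ reciprocalPoly g s ≈ₚ negₚ g)
    conclude (inj₁ eq) = G0²≢1 (cong (λ x → x * x) {y = + 1} (sym (ι-injective (trans (sym lead) (trans (eq 0) (rep 0))))))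
    conclude (inj₂ eq) = G0²≢1 (proj₂ (unit-product (G 0) (- + 1) (trans (ℤ.*-comm (G 0) (- + 1)) (sym (ι-injective
      (trans (sym lead) (trans (eq 0) (trans (coeff-scale (ℚ.- ℚ.1ℚ) g 0)
        (trans (cong (ι (- + 1) ℚ.*_) (rep 0)) (ι-* (- + 1) (G 0)))))))))))

-- The scalar c is the coefficient of G at the degree of H. Being nonzero it is the leading one, so
-- c = 1.
monic-associated : ∀ {d e G H} g h → Monic d G → Monic e H →
  (∀ i → coeff g i ≡ ι (G i)) → (∀ i → coeff h i ≡ ι (H i)) → Associated g h → G ≗ H
monic-associated {d} {e} {G} {H} g h mG mH rg rh (c , c≢0 , eq) i =
  ι-injective (trans (G≡cH i) (trans (cong (ℚ._* ι (H i)) c≡1) (ℚ.*-identityˡ (ι (H i)))))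
  where
  open ≡-Reasoning
  G≡cH : ∀ i → ι (G i) ≡ c ℚ.* ι (H i)
  G≡cH i = begin
    ι (G i)             ≡⟨ rg i ⟨
    coeff g i           ≡⟨ eq i ⟩
    coeff (scale c h) i ≡⟨ coeff-scale c h i ⟩
    c ℚ.* coeff h i     ≡⟨ cong (c ℚ.*_) (rh i) ⟩
    c ℚ.* ι (H i)       ∎
  Ge≡c : ι (G e) ≡ c
  Ge≡c = trans (G≡cH e) (trans (cong (λ x → c ℚ.* ι x) (proj₁ mH)) (ℚ.*-identityʳ c))
  d≡e : d ≡ e
  d≡e = HasDeg-unique (Monic⇒HasDeg mG)
    ((λ z → c≢0 (trans (sym Ge≡c) (cong ι z))) ,
     λ j e<j → ι-injective (trans (G≡cH j) (trans (cong (λ x → c ℚ.* ι x) (proj₂ mH j e<j)) (ℚ.*-zeroʳ c))))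
  c≡1 : c ≡ ℚ.1ℚ
  c≡1 = trans (sym Ge≡c) (cong ι (trans (cong G (sym d≡e)) (proj₁ mG)))

-- The factors of the trinomial

⊛-swap : ∀ f g h → f ⊛ (g ⊛ h) ≗ g ⊛ (f ⊛ h)
⊛-swap f g h i =
  trans (sym (⊛-assoc f g h i)) (trans (⊛-congʳ h (⊛-comm f g) i) (⊛-assoc g f h i))

Divides : Seq → Seq → Set
Divides g f = ∃ λ r → Bounded r × f ≗ g ⊛ r

Factor⇒Bounded : ∀ {x} → Factor x → Bounded (proj₂ x)
Factor⇒Bounded {d , _} ((_ , b) , _) = suc (suc d) , b

∏-Bounded : ∀ {gs} → All Factor gs → Bounded (∏ gs)
∏-Bounded []       = 1 , proj₂ HasDeg-𝟙
∏-Bounded (f ∷ fs) = Bounded-⊛ (Factor⇒Bounded f) (∏-Bounded fs)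

∏-divides : ∀ {gs} → All Factor gs → All (λ x → Divides (proj₂ x) (∏ gs)) gs
∏-divides [] = []
∏-divides {(d , g) ∷ gs} (f ∷ fs) =
  (∏ gs , ∏-Bounded fs , λ _ → refl) ∷
  All.map (λ { {_ , h} (r , br , eq) →
    g ⊛ r , Bounded-⊛ (Factor⇒Bounded f) br , λ i → trans (⊛-congˡ g eq i) (⊛-swap g h r i) })
    (∏-divides fs)

polynomial : ℕ × Seq → Poly
polynomial (d , g) = toPoly (suc (suc d)) g

polynomial-coeff : ∀ {x} → Factor x → ∀ i → coeff (polynomial x) i ≡ ι (proj₂ x i)
polynomial-coeff ((_ , b) , _) = coeff-toPoly b

SquareFree-⊛ : ∀ {f g} → Bounded f → SquareFree (f ⊛ g) → SquareFree g
SquareFree-⊛ {f} {g} bf sf {g = h} {w} mh bw eq = sf mh (Bounded-⊛ bf bw) λ i →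
  trans (⊛-congˡ f eq i) (trans (⊛-swap f h (h ⊛ w) i) (⊛-congˡ h (⊛-swap f h w) i))

SquareFree-resp : ∀ {f g} → f ≗ g → SquareFree f → SquareFree g
SquareFree-resp f≗g sf mh bw eq = sf mh bw λ i → trans (f≗g i) (eq i)

-- A later factor divides the product of the rest; if it were associated to g it would equal g, and
-- g² would divide the whole product.
factors-distinct : ∀ {gs} → All Factor gs → SquareFree (∏ gs) →
  AllPairs (λ x y → ¬ Associated (polynomial x) (polynomial y)) gs
factors-distinct [] sf = []
factors-distinct {(d , g) ∷ gs} (f ∷ fs) sf =
  All.zipWith
    (λ { {y} (fh@(mh , _) , (r , br , eq)) assoc →
      sf (proj₁ f) br λ i → ⊛-congˡ g (λ k → trans (eq k) (⊛-congʳ r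
        (λ l → sym (monic-associated (polynomial (d , g)) (polynomial y) (proj₁ f) mh (polynomial-coeff f) (polynomial-coeff fh) assoc l)) k)) i })
    (fs , ∏-divides fs)
  ∷ factors-distinct fs (SquareFree-⊛ (Factor⇒Bounded f) sf)

Represents-∏ : ∀ {gs} → All Factor gs → Represents (+ 1) (prodₚ (map polynomial gs)) (∏ gs)
Represents-∏ [] = represents₁ {oneₚ} λ { zero → refl ; (suc i) → refl }
Represents-∏ {x ∷ gs} (f ∷ fs) =
  Represents-* {+ 1} {+ 1} (polynomial x) (prodₚ (map polynomial gs))
    (represents₁ {polynomial x} (polynomial-coeff f)) (Represents-∏ fs)

length-bound : ∀ {p gs} → All (λ (x : ℕ × Seq) → p ≤ ∣ proj₂ x 0 ∣) gs → p ℕ.^ length gs ≤ ∣ ∏ gs 0 ∣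
length-bound [] = ℕ.≤-refl
length-bound {p} {(_ , g) ∷ gs} (le ∷ les) =
  ℕ.≤-trans (ℕ.*-mono-≤ le (length-bound les)) (ℕ.≤-reflexive (sym (ℤ.abs-* (g 0) (∏ gs 0))))

-- By Euclid's lemma p divides x or its cofactor; in the latter case p cancels and the exponent
-- drops.
∣prime-power : ∀ {p x} k → Prime p → x ℕ.∣ p ℕ.^ k → x ≢ 1 → p ℕ.∣ x
∣prime-power zero pp x∣ x≢1 = ⊥-elim (x≢1 (ℕ.∣1⇒≡1 x∣))
∣prime-power {p} {x} (suc k) pp (ℕ.divides y eq) x≢1
  with euclidsLemma y x pp (ℕ.divides (p ℕ.^ k) (trans (sym eq) (ℕ.*-comm p (p ℕ.^ k))))
... | inj₂ p∣x = p∣x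
... | inj₁ (ℕ.divides y′ refl) = ∣prime-power k pp (ℕ.divides y′ (ℕ.*-cancelˡ-≡ _ _ p ⦃ prime⇒nonZero pp ⦄ (begin
  p ℕ.* p ℕ.^ k      ≡⟨ eq ⟩
  y′ ℕ.* p ℕ.* x     ≡⟨ cong (ℕ._* x) (ℕ.*-comm y′ p) ⟩
  p ℕ.* y′ ℕ.* x     ≡⟨ ℕ.*-assoc p y′ x ⟩
  p ℕ.* (y′ ℕ.* x)   ∎))) x≢1
  where open ≡-Reasoning

^-cancel-≤ : ∀ {p} k l → 2 ≤ p → p ℕ.^ k ≤ p ℕ.^ l → k ≤ l
^-cancel-≤ {p} k l 2≤p le = ℕ.≮⇒≥ λ l<k → ℕ.<⇒≱ (ℕ.^-monoʳ-< p 2≤p l<k) le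

coeff-monomial : ∀ n z i → coeff (monomial n (ι z)) i ≡ ι (mono n z i)
coeff-monomial zero    z zero    = refl
coeff-monomial zero    z (suc i) = refl
coeff-monomial (suc n) z zero    = refl
coeff-monomial (suc n) z (suc i) = coeff-monomial n z i

coeff-trinomial : ∀ n m s t p k i →
  coeff (trinomial n m (ι s) (ι t) p k) i ≡ ι (Tri n m s (t * + (p ℕ.^ k)) i)
coeff-trinomial n m s t p k i = begin
  coeff (monomial n ℚ.1ℚ +ₚ (monomial m (ι s) +ₚ (ι t ℚ.* ℕ→ℚ P ∷ []))) i
    ≡⟨ coeff-+ (monomial n ℚ.1ℚ) _ i ⟩
  coeff (monomial n ℚ.1ℚ) i ℚ.+ coeff (monomial m (ι s) +ₚ (ι t ℚ.* ℕ→ℚ P ∷ [])) i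
    ≡⟨ cong₂ ℚ._+_ (coeff-monomial n (+ 1) i) (coeff-+ (monomial m (ι s)) _ i) ⟩
  ι (mono n (+ 1) i) ℚ.+ (coeff (monomial m (ι s)) i ℚ.+ coeff (ι t ℚ.* ℕ→ℚ P ∷ []) i)
    ≡⟨ cong (ι (mono n (+ 1) i) ℚ.+_) (cong₂ ℚ._+_ (coeff-monomial m s i)
         (trans (cong (λ c → coeff (c ∷ []) i) constant) (coeff-monomial 0 (t * + P) i))) ⟩
  ι (mono n (+ 1) i) ℚ.+ (ι (mono m s i) ℚ.+ ι (mono 0 (t * + P) i))
    ≡⟨ cong (ι (mono n (+ 1) i) ℚ.+_) (ι-+ (mono m s i) _) ⟩
  ι (mono n (+ 1) i) ℚ.+ ι (mono m s i + mono 0 (t * + P) i)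
    ≡⟨ ι-+ (mono n (+ 1) i) _ ⟩
  ι (Tri n m s (t * + P) i) ∎
  where
  open ≡-Reasoning
  P = p ℕ.^ k
  constant : ι t ℚ.* ℕ→ℚ P ≡ ι (t * + P)
  constant = trans (cong (ι t ℚ.*_) (ℚ.↥p/↧p≡p (ι (+ P)))) (ι-* t (+ P))

Tri-Monic : ∀ {n m s c} → 1 ≤ m → m < n → Monic n (Tri n m s c)
Tri-Monic {n} {m} {s} {c} 1≤m m<n =
  cong₂ _+_ (mono-at n (+ 1)) (cong₂ _+_ (mono-off m s n (ℕ.<⇒≢ m<n)) (mono-off 0 c n (ℕ.<⇒≢ 0<n))) ,
  λ i n<i → cong₂ _+_ (mono-off n (+ 1) i (ℕ.<⇒≢ n<i))
    (cong₂ _+_ (mono-off m s i (ℕ.<⇒≢ (ℕ.<-trans m<n n<i))) (mono-off 0 c i (ℕ.<⇒≢ (ℕ.<-trans 0<n n<i))))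
  where
  0<n : 0 < n
  0<n = ℕ.<-trans 1≤m m<n

Tri-0 : ∀ {n m s c} → 1 ≤ m → m < n → Tri n m s c 0 ≡ c
Tri-0 {c = c} (s≤s _) (s≤s _) = trans (ℤ.+-identityˡ _) (ℤ.+-identityˡ c)

sign-integer : ∀ {ε} → IsSign ε → ∃ λ s → ε ≡ ι s × ∣ s ∣ ≡ 1
sign-integer (inj₁ refl) = + 1 , refl , refl
sign-integer (inj₂ refl) = - + 1 , refl , refl

-- p^k ≥ p² ≥ 2² = 4. Here k ≥ 2 enters: the bound fails for p^k = 2.
3≤prime-power : ∀ {p} k → Prime p → 2 ≤ k → 3 ≤ p ℕ.^ k
3≤prime-power {p} k pp 2≤k = ℕ.≤-trans (s≤s (s≤s (s≤s z≤n)))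
  (ℕ.≤-trans (ℕ.^-monoˡ-≤ 2 2≤p) (ℕ.^-monoʳ-≤ p ⦃ prime⇒nonZero pp ⦄ 2≤k))
  where
  2≤p : 2 ≤ p
  2≤p = ℕ.nonTrivial⇒n>1 p ⦃ prime⇒nonTrivial pp ⦄

theorem3 : (p k n m : ℕ) (ε₁ ε₂ : ℚ) → Prime p → 2 ≤ k → 1 ≤ m → m < n
    → IsSign ε₁ → IsSign ε₂
    → Σ (List Poly) λ gs → length gs ≤ k
    × All (λ g → Irreducible g × NonReciprocal g) gs
    × AllPairs (λ g h → ¬ Associated g h) gs
    × prodₚ gs ≈ₚ trinomial n m ε₁ ε₂ p k
theorem3 p k n m ε₁ ε₂ pp 2≤k 1≤m m<n sign₁ sign₂
  with sign-integer sign₁ | sign-integer sign₂ | ℕ.m≤n⇒∃[o]m+o≡n (ℕ.<⇒≤ m<n)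
... | s , refl , ∣s∣≡1 | t , refl , ∣t∣≡1 | j , refl =
  map polynomial gs ,
  subst (_≤ k) (sym (length-map polynomial gs)) (^-cancel-≤ (length gs) k 2≤p length≤) ,
  All.map⁺ (All.map irreducible-nonReciprocal factors) ,
  AllPairs.map⁺ (factors-distinct fs (SquareFree-resp F≗∏
    (Tri-squareFree m j s c 1≤m (ℕ.+-cancelˡ-< m 0 j (subst (_< m ℕ.+ j) (sym (ℕ.+-identityʳ m)) m<n)) ∣s∣≡1 c≢0))) ,
  λ i → trans (Represents₁ {prodₚ (map polynomial gs)} (Represents-∏ fs) i)
    (trans (cong ι (sym (F≗∏ i))) (sym (coeff-trinomial (m ℕ.+ j) m s t p k i)))
  where
  c = t * + (p ℕ.^ k)
  F = Tri (m ℕ.+ j) m s c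
  2≤p : 2 ≤ p
  2≤p = ℕ.nonTrivial⇒n>1 p ⦃ prime⇒nonTrivial pp ⦄
  ∣c∣≡p^k : ∣ c ∣ ≡ p ℕ.^ k
  ∣c∣≡p^k = trans (ℤ.abs-* t (+ (p ℕ.^ k)))
    (trans (cong (ℕ._* p ℕ.^ k) ∣t∣≡1) (ℕ.*-identityˡ (p ℕ.^ k)))
  3≤∣c∣ : 3 ≤ ∣ c ∣
  3≤∣c∣ = subst (3 ≤_) (sym ∣c∣≡p^k) (3≤prime-power k pp 2≤k)
  c≢0 : c ≢ + 0
  c≢0 z with () ← subst (λ x → 3 ≤ ∣ x ∣) z 3≤∣c∣
  F0≡c : F 0 ≡ c
  F0≡c = Tri-0 {s = s} 1≤m m<n
  factorisation : ∃ λ gs → All Factor gs × F ≗ ∏ gs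
  factorisation = factor (m ℕ.+ j) ℕ.≤-refl (Tri-Monic 1≤m m<n) (λ z → c≢0 (trans (sym F0≡c) z))
  gs = proj₁ factorisation
  fs = proj₁ (proj₂ factorisation)
  F≗∏ = proj₂ (proj₂ factorisation)
  DivisorOfF : ℕ × Seq → Set
  DivisorOfF x = Factor x × Divides (proj₂ x) F
  factors : All DivisorOfF gs
  factors = All.zipWith (λ (f , r , br , eq) → f , r , br , λ i → trans (F≗∏ i) (eq i))
    (fs , ∏-divides fs)
  nonunit : ∀ {x} → DivisorOfF x → proj₂ x 0 * proj₂ x 0 ≢ + 1
  nonunit {d , g} (f@(mg , _) , r , br , eq) unit =
    proj₁ (Monic⇒HasDeg mg) (unit-constant⇒const m j s c 1≤m ∣s∣≡1 3≤∣c∣ (Factor⇒Bounded f) br eq unit (suc d) (s≤s z≤n))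
  nonzero : ∀ {x} → DivisorOfF x → proj₂ x 0 ≢ + 0
  nonzero (_ , r , _ , eq) z = c≢0 (trans (sym F0≡c) (trans (eq 0) (cong (_* r 0) z)))
  irreducible-nonReciprocal : ∀ {x} → DivisorOfF x → Irreducible (polynomial x) × NonReciprocal (polynomial x)
  irreducible-nonReciprocal {x} D@(f@(mg , irr) , _) =
    irreducible (polynomial x) mg irr (polynomial-coeff f) , nonReciprocal (polynomial x) mg (nonzero D) (nonunit D) (polynomial-coeff f)
  -- g(0) divides p^k and is not ±1, so p divides it.
  p≤constant : ∀ {x} → DivisorOfF x → p ≤ ∣ proj₂ x 0 ∣
  p≤constant {_ , g} D@(_ , r , _ , eq) = ℕ.∣⇒≤ ⦃ ℕ.≢-nonZero (nonzero D ∘ ℤ.∣i∣≡0⇒i≡0) ⦄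
    (∣prime-power k pp g0∣p^k λ ∣g0∣≡1 → nonunit D (square (abs≡1 (g 0) ∣g0∣≡1)))
    where
    g0∣p^k : ∣ g 0 ∣ ℕ.∣ p ℕ.^ k
    g0∣p^k = ℕ.divides ∣ r 0 ∣ (begin
      p ℕ.^ k                ≡⟨ ∣c∣≡p^k ⟨
      ∣ c ∣                  ≡⟨ cong ∣_∣ (trans (sym F0≡c) (eq 0)) ⟩
      ∣ g 0 * r 0 ∣          ≡⟨ ℤ.abs-* (g 0) (r 0) ⟩
      ∣ g 0 ∣ ℕ.* ∣ r 0 ∣    ≡⟨ ℕ.*-comm ∣ g 0 ∣ ∣ r 0 ∣ ⟩
      ∣ r 0 ∣ ℕ.* ∣ g 0 ∣    ∎)
      where open ≡-Reasoning
    square : g 0 ≡ + 1 ⊎ g 0 ≡ - + 1 → g 0 * g 0 ≡ + 1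
    square (inj₁ e) = cong (λ x → x * x) e
    square (inj₂ e) = cong (λ x → x * x) e
  length≤ : p ℕ.^ length gs ≤ p ℕ.^ k
  length≤ = subst (p ℕ.^ length gs ≤_) (trans (cong ∣_∣ (trans (sym (F≗∏ 0)) F0≡c)) ∣c∣≡p^k)
    (length-bound (All.map p≤constant factors))
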